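{- The problem $\mathrm{Synthesis}(\mathrm{FO}^2[\sim,<,+1],\{0\},\{0\},\mathbb{N})$ is undecidable. That is, there is no algorithm that, given a finite alphabet $A=A_s\uplus A_e$ and a sentence $\varphi$ of the two-variable fragment $\mathrm{FO}^2_A[\sim,<,+1]$, decides whether there exists $k\in\mathbb{N}$ with $(0,0,k)\in\mathrm{Win}(\varphi)$.
   Context: Process types: $\mathbb{T}=\{s,e,se\}$ (System, Environment, both). A process triple $\mathbb{P}=(\mathbb{P}_s,\mathbb{P}_e,\mathbb{P}_{se})$ consists of pairwise disjoint finite sets; $\mathbb{P}$ also denotes their union. A finite action alphabet is partitioned as $A=A_s\uplus A_e$. Events: $\Sigma_s=A_s\times(\mathbb{P}_s\cup\mathbb{P}_{se})$, $\Sigma_e=A_e\times(\mathbb{P}_e\cup\mathbb{P}_{se})$, $\Sigma=\Sigma_s\cup\Sigma_e$. A $\mathbb{P}$-execution is a word $w\in\Sigma^*\cup\Sigma^\omega$; $\mathrm{Pos}(w)$ is its set of positions ($\{1,\dots,|w|\}$ or $\{1,2,\dots\}$). Logic $\mathrm{FO}_A[\sim,<,+1]$: $\varphi::=\theta(x)\mid a(x)\mid x=y\mid x\sim y\mid x<y\mid +1(x,y)\mid\neg\varphi\mid\varphi\vee\varphi\mid\exists x.\varphi$ with $\theta\in\mathbb{T}$, $a\in A$. It is evaluated on $(\mathbb{P},w)$ with $w=(a_1,p_1)(a_2,p_2)\dots$ viewed as the structure with universe $\mathbb{P}\uplus\mathrm{Pos}(w)$, where $\theta$ is interpreted as $\mathbb{P}_\theta$,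 $a$ as $\{i\in\mathrm{Pos}(w)\mid a_i=a\}$, $<$ and $+1$ as the order and successor on positions, and $\sim$ as the least equivalence relation on $\mathbb{P}\uplus\mathrm{Pos}(w)$ containing $(p,i)$ whenever $p=p_i$ and $(i,j)$ whenever $p_i=p_j$. $\mathrm{FO}^2_A[\sim,<,+1]$ is the fragment using only two (reusable) variable names. A $\mathbb{P}$-strategy is a map $f:\Sigma^*\to\Sigma_s\cup\{\varepsilon\}$. An execution $w=\sigma_1\sigma_2\dots$ is $f$-compatible if $f(\sigma_1\dots\sigma_{i-1})=\sigma_i$ for every $i$ with $\sigma_i\in\Sigma_s$; it is $f$-fair if (i) when $w$ is finite, $f(w)=\varepsilon$, and (ii) when $w$ is infinite and $f(\sigma_1\dots\sigma_{i-1})\ne\varepsilon$ for infinitely many $i$, then $\sigma_j\in\Sigma_s$ for infinitely many $j$. $f$ is $\mathbb{P}$-winning for a sentence $\varphi$ if every $f$-compatible, $f$-fair $\mathbb{P}$-execution $w$ satisfies $(\mathbb{P},w)\models\varphi$. $\mathrm{Win}(\varphi)$ is the set of $(k_s,k_e,k_{se})\in\mathbb{N}^3$ such that for some $\mathbb{P}$ with $|\mathbb{P}_\theta|=k_\theta$ ($\theta\in\mathbb{T}$) there is a $\mathbb{P}$-strategy that is $\mathbb{P}$-winning for $\varphi$. For a logic fragment $\mathfrak{F}[R]$ and sets $N_s,N_e,N_{se}\subseteq\mathbb{N}$, $\mathrm{Synthesis}(\mathfrak{F}[R],N_s,N_e,N_{se})$ asks, given $A=A_s\uplus A_e$ and a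 sentence $\varphi\in\mathfrak{F}_A[R]$, whether $\mathrm{Win}(\varphi)\cap(N_s\times N_e\times N_{se})\neq\emptyset$. -}

module Defs where

open import Data.Nat using (ℕ; zero; suc; _+_; _*_; _^_; _≤_; _<_)
open import Data.Fin using (Fin; toℕ) renaming (zero to fz; suc to fs; _≟_ to _≟ᶠ_)
open import Data.Bool using (Bool; true; false; _∨_; if_then_else_)
open import Data.List using (List; []; _∷_; length; take; applyUpTo; tabulate)
import Data.List as L
open import Data.Vec using (Vec; _∷_; head; lookup; replicate; _[_]≔_; _[_]%=_)
open import Data.Maybe using (Maybe; just; nothing)
import Data.Maybe as M
open import Data.Product using (Σ; _×_; _,_; proj₁; proj₂)
open import Data.Sum using (_⊎_; inj₁; inj₂)
open import Data.Empty using (⊥)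
open import Relation.Nullary using (¬_)
open import Relation.Nullary.Decidable using (⌊_⌋)
open import Relation.Binary.PropositionalEquality using (_≡_; _≢_)

data Ty : Set where
  s e se : Ty

-- Syntax of FO²_A[∼,<,+1] over the action alphabet A = Fin n.
-- Only two variable names (Fin 2), which may be requantified.

Var : Set
Var = Fin 2

data Form (n : ℕ) : Set where
  ty   : Ty → Var → Form n
  act  : Fin n → Var → Form n
  eq   : Var → Var → Form n
  sim  : Var → Var → Form n
  lt   : Var → Var → Form n
  succ : Var → Var → Form n
  neg  : Form n → Form n
  or   : Form n → Form n → Form n
  ex   : Var → Form n → Form n

free : ∀ {n} → Var → Form n → Bool
free v (ty _ x)   = ⌊ v ≟ᶠ x ⌋
free v (act _ x)  = ⌊ v ≟ᶠ x ⌋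
free v (eq x y)   = ⌊ v ≟ᶠ x ⌋ ∨ ⌊ v ≟ᶠ y ⌋
free v (sim x y)  = ⌊ v ≟ᶠ x ⌋ ∨ ⌊ v ≟ᶠ y ⌋
free v (lt x y)   = ⌊ v ≟ᶠ x ⌋ ∨ ⌊ v ≟ᶠ y ⌋
free v (succ x y) = ⌊ v ≟ᶠ x ⌋ ∨ ⌊ v ≟ᶠ y ⌋
free v (neg φ)    = free v φ
free v (or φ ψ)   = free v φ ∨ free v ψ
free v (ex x φ)   = if ⌊ v ≟ᶠ x ⌋ then false else free v φ

Sentence : ∀ {n} → Form n → Set
Sentence φ = (free fz φ ≡ false) × (free (fs fz) φ ≡ false)

-- Semantics, games, strategies and Win.
-- Parameters: alphabet A = Fin nA, sysAct a = true iff a ∈ A_s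
-- (otherwise a ∈ A_e), and the sizes (ks, ke, kse) of 𝕡_s, 𝕡_e, 𝕡_se.
-- Canonical process triple: 𝕡_θ = {θ} × Fin k_θ (pairwise disjoint).

module Sem (nA : ℕ) (sysAct : Fin nA → Bool) (ks ke kse : ℕ) where

  size : Ty → ℕ
  size s  = ks
  size e  = ke
  size se = kse

  Proc : Set
  Proc = Σ Ty (λ θ → Fin (size θ))

  -- Allowed b θ : an action with sysAct = b may be performed by a
  -- process of type θ  (Σ_s = A_s × (𝕡_s ∪ 𝕡_se), Σ_e = A_e × (𝕡_e ∪ 𝕡_se))
  data Allowed : Bool → Ty → Set where
    sys-s  : Allowed true s
    sys-se : Allowed true se
    env-e  : Allowed false e
    env-se : Allowed false se

  Event : Set
  Event = Σ (Fin nA) λ a → Σ Proc λ p → Allowed (sysAct a) (proj₁ p)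

  action : Event → Fin nA
  action σ = proj₁ σ

  proc : Event → Proc
  proc σ = proj₁ (proj₂ σ)

  IsSys : Event → Set
  IsSys σ = sysAct (action σ) ≡ true

  Exec : Set
  Exec = List Event ⊎ (ℕ → Event)

  Pos : Exec → Set
  Pos (inj₁ l) = Fin (length l)
  Pos (inj₂ f) = ℕ

  -- positions are numbered from 0 here (a harmless shift)
  pos : (w : Exec) → Pos w → ℕ
  pos (inj₁ l) i = toℕ i
  pos (inj₂ f) i = i

  letter : (w : Exec) → Pos w → Event
  letter (inj₁ l) i = L.lookup l i
  letter (inj₂ f) i = f i

  prefix : (w : Exec) → Pos w → List Event
  prefix (inj₁ l) i = take (toℕ i) l
  prefix (inj₂ f) i = applyUpTo f i

  U : Exec → Set
  U w = Proc ⊎ Pos w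

  data Sim (w : Exec) : U w → U w → Set where
    gen-pi  : (p : Proc) (i : Pos w) → p ≡ proc (letter w i) → Sim w (inj₁ p) (inj₂ i)
    gen-ij  : (i j : Pos w) → proc (letter w i) ≡ proc (letter w j) → Sim w (inj₂ i) (inj₂ j)
    sim-refl  : ∀ {u} → Sim w u u
    sim-sym   : ∀ {u v} → Sim w u v → Sim w v u
    sim-trans : ∀ {u v t} → Sim w u v → Sim w v t → Sim w u t

  HasTy : (w : Exec) → Ty → U w → Set
  HasTy w θ (inj₁ p) = proj₁ p ≡ θ
  HasTy w θ (inj₂ i) = ⊥

  HasAct : (w : Exec) → Fin nA → U w → Set
  HasAct w a (inj₁ p) = ⊥
  HasAct w a (inj₂ i) = action (letter w i) ≡ a

  Lt : (w : Exec) → U w → U w → Set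
  Lt w (inj₂ i) (inj₂ j) = pos w i < pos w j
  Lt w _        _        = ⊥

  Succ : (w : Exec) → U w → U w → Set
  Succ w (inj₂ i) (inj₂ j) = suc (pos w i) ≡ pos w j
  Succ w _        _        = ⊥

  Env : Exec → Set
  Env w = Var → Maybe (U w)

  lift₁ : ∀ {w} → (U w → Set) → Maybe (U w) → Set
  lift₁ P (just u) = P u
  lift₁ P nothing  = ⊥

  lift₂ : ∀ {w} → (U w → U w → Set) → Maybe (U w) → Maybe (U w) → Set
  lift₂ R (just u) (just v) = R u v
  lift₂ R _        _        = ⊥

  update : ∀ {w} → Env w → Var → U w → Env w
  update ρ x u y = if ⌊ y ≟ᶠ x ⌋ then just u else ρ y

  ⟦_⟧ : ∀ {w} → Form nA → Env w → Set
  ⟦_⟧ {w} (ty θ x)   ρ = lift₁ (HasTy w θ) (ρ x)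
  ⟦_⟧ {w} (act a x)  ρ = lift₁ (HasAct w a) (ρ x)
  ⟦_⟧ {w} (eq x y)   ρ = lift₂ _≡_ (ρ x) (ρ y)
  ⟦_⟧ {w} (sim x y)  ρ = lift₂ (Sim w) (ρ x) (ρ y)
  ⟦_⟧ {w} (lt x y)   ρ = lift₂ (Lt w) (ρ x) (ρ y)
  ⟦_⟧ {w} (succ x y) ρ = lift₂ (Succ w) (ρ x) (ρ y)
  ⟦_⟧ {w} (neg φ)    ρ = ¬ ⟦ φ ⟧ ρ
  ⟦_⟧ {w} (or φ ψ)   ρ = ⟦ φ ⟧ ρ ⊎ ⟦ ψ ⟧ ρ
  ⟦_⟧ {w} (ex x φ)   ρ = Σ (U w) λ u → ⟦ φ ⟧ (update ρ x u)

  Models : (w : Exec) → Form nA → Set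
  Models w φ = ⟦_⟧ {w} φ (λ _ → nothing)

  -- strategies f : Σ* → Σ_s ∪ {ε}   (nothing = ε)
  Strategy : Set
  Strategy = List Event → Maybe (Σ Event IsSys)

  out : Strategy → List Event → Maybe Event
  out f u = M.map proj₁ (f u)

  Compatible : Strategy → Exec → Set
  Compatible f w = (i : Pos w) → IsSys (letter w i) → out f (prefix w i) ≡ just (letter w i)

  InfinitelyOften : (ℕ → Set) → Set
  InfinitelyOften P = (n : ℕ) → Σ ℕ λ i → n ≤ i × P i

  Fair : Strategy → Exec → Set
  Fair f (inj₁ l) = out f l ≡ nothing
  Fair f (inj₂ g) = InfinitelyOften (λ i → out f (applyUpTo g i) ≢ nothing)
                  → InfinitelyOften (λ j → IsSys (g j))

  Winning : Strategy → Form nA → Set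
  Winning f φ = (w : Exec) → Compatible f w → Fair f w → Models w φ

  InWin : Form nA → Set
  InWin φ = Σ Strategy λ f → Winning f φ

pair : ℕ → ℕ → ℕ
pair a b = 2 ^ a * suc (2 * b)

encList : List ℕ → ℕ
encList []       = 0
encList (x ∷ xs) = pair x (encList xs)

tyCode : Ty → ℕ
tyCode s  = 0
tyCode e  = 1
tyCode se = 2

encForm : ∀ {n} → Form n → ℕ
encForm (ty t x)   = pair 0 (pair (tyCode t) (toℕ x))
encForm (act a x)  = pair 1 (pair (toℕ a) (toℕ x))
encForm (eq x y)   = pair 2 (pair (toℕ x) (toℕ y))
encForm (sim x y)  = pair 3 (pair (toℕ x) (toℕ y))
encForm (lt x y)   = pair 4 (pair (toℕ x) (toℕ y))
encForm (succ x y) = pair 5 (pair (toℕ x) (toℕ y))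
encForm (neg φ)    = pair 6 (encForm φ)
encForm (or φ ψ)   = pair 7 (pair (encForm φ) (encForm ψ))
encForm (ex x φ)   = pair 8 (pair (toℕ x) (encForm φ))

encInstance : (nA : ℕ) → (Fin nA → Bool) → Form nA → ℕ
encInstance nA sysAct φ =
  pair nA (pair (encList (tabulate (λ a → if sysAct a then 1 else 0))) (encForm φ))

SynthesisFO2-00N : ℕ → Set
SynthesisFO2-00N n =
  Σ ℕ λ nA → Σ (Fin nA → Bool) λ sysAct → Σ (Form nA) λ φ →
    Sentence φ × (encInstance nA sysAct φ ≡ n) ×
    (Σ ℕ λ k → Sem.InWin nA sysAct 0 0 k φ)

-- Model of computation: counter (Minsky) machines, input and output in
-- register 0.

data Instr (r : ℕ) : Set where
  inc   : Fin r → ℕ → Instr r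
  decjz : Fin r → ℕ → ℕ → Instr r    -- if zero jump to 1st, else decrement and jump to 2nd

record Machine : Set where
  field
    nregs : ℕ
    prog  : List (Instr (suc nregs))

Config : ℕ → Set
Config r = ℕ × Vec ℕ (suc r)

nth : ∀ {A : Set} → List A → ℕ → Maybe A
nth []       _       = nothing
nth (x ∷ xs) zero    = just x
nth (x ∷ xs) (suc k) = nth xs k

stepI : ∀ {r} → Instr (suc r) → Vec ℕ (suc r) → Config r
stepI (inc x j) v = j , (v [ x ]%= suc)
stepI (decjz x j k) v with lookup v x
... | zero  = j , v
... | suc m = k , (v [ x ]≔ m)

step : (M : Machine) → Config (Machine.nregs M) → Maybe (Config (Machine.nregs M))
step M (pc , v) = M.map (λ ins → stepI ins v) (nth (Machine.prog M) pc)

run : (M : Machine) → ℕ → Config (Machine.nregs M) → Config (Machine.nregs M)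
run M zero    c = c
run M (suc t) c with step M c
... | nothing = c
... | just c' = run M t c'

initial : (M : Machine) → ℕ → Config (Machine.nregs M)
initial M n = 0 , (n ∷ replicate _ 0)

HaltsWith : Machine → ℕ → ℕ → Set
HaltsWith M n o = Σ ℕ λ t →
  (step M (run M t (initial M n)) ≡ nothing) × (head (proj₂ (run M t (initial M n))) ≡ o)

Decides : Machine → (ℕ → Set) → Set
Decides M P = (n : ℕ) → (P n → HaltsWith M n 1) × (¬ P n → HaltsWith M n 0)

Undecidable : (ℕ → Set) → Set
Undecidable P = ¬ (Σ Machine λ M → Decides M P)

{-# OPTIONS --safe #-}
module Submission where

-- A counter machine is simulated by the game as follows.  An action is a
-- transition; a process that plays an increment of c holds a token of c until it
-- plays a decrement of c, so that the value of c is the number of its tokens.  All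
-- local conditions are expressible with two variables, except that a counter
-- tested for zero has no tokens left, which needs three.  This is left to
-- Environment, who may answer a test by an action of a process p: System loses if p
-- holds a token, which is again a two-variable property of the position of that
-- answer.  Hence System wins for some number of processes iff the machine halts.
--
-- Given a machine M deciding the problem, let the simulated machine compute the
-- code n of its own instance, run M on n and halt iff the output is 0.  To make it
-- know n without a universal machine, the formula prescribes that the play starts
-- with α increments of A and β increments of B.  As pair a is an affine function,
-- n = α + β E, where E is the code of the prescribing subformula, for some α and β
-- that do not depend on the prescribed numbers; and E is computed from α and β by
-- iterating affine functions.

open import Defs
open import Data.Bool using (Bool; true; false; if_then_else_)
import Data.Bool as B
open import Data.Empty using (⊥; ⊥-elim)
open import Data.Fin using (Fin; zero; suc; toℕ; fromℕ<)
import Data.Fin as F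
open import Data.Fin.Properties using (toℕ-injective; toℕ-fromℕ<)
open import Data.List using (List; []; _∷_; length; take; applyUpTo; tabulate; _++_; _∷ʳ_)
import Data.List as L
import Data.List.Properties as LP
open import Data.List.Membership.Propositional using (_∈_)
open import Data.List.Membership.Propositional.Properties using (∈-filter⁺; ∈-filter⁻; ∈-allFin; ∈-cartesianProduct⁺; ∈-++⁺ˡ; ∈-++⁺ʳ; ∈-++⁻; ∈-map⁺; ∈-map⁻; ∈-lookup)
open import Data.List.Relation.Unary.All using ([]; _∷_)
import Data.List.Relation.Unary.All as All
open import Data.List.Relation.Unary.AllPairs using ([]; _∷_)
open import Data.List.Relation.Unary.Any using (here; there)
import Data.List.Relation.Unary.Any as Any
open import Data.List.Relation.Unary.Any.Properties using (lookup-index)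
open import Data.List.Relation.Unary.Unique.Propositional using (Unique)
open import Data.Maybe using (Maybe; just; nothing)
import Data.Maybe as M
open import Data.Maybe.Properties using (just-injective)
open import Data.Nat using (ℕ; zero; suc; _+_; _*_; _^_; _⊓_; _≤_; _<_; z≤n; s≤s)
open import Data.Nat.Properties
open import Data.Product using (Σ; _×_; _,_; proj₁; proj₂)
open import Data.Sum using (_⊎_; inj₁; inj₂)
import Data.Sum as Sum
open import Data.Vec using (Vec; []; _∷_; lookup; replicate; _[_]≔_; _[_]%=_)
import Data.Vec as V
import Data.Vec.Properties as VP
open import Function using (_∘_)
open import Relation.Binary.Construct.Closure.ReflexiveTransitive using (Star; _◅_; _◅◅_) renaming (ε to done)
open import Relation.Binary.Definitions using (tri<; tri≈; tri>)
open import Relation.Binary.PropositionalEquality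
open import Relation.Nullary using (¬_; Dec; yes; no)
open import Relation.Nullary.Decidable using (_×-dec_; ¬?; map′; decidable-stable)

-- Lists

-- A process may increment a given counter at most once and decrement it at most once. Holding a
-- token of c then means an earlier increment and no earlier decrement, so this status needs one
-- variable besides the position concerned. Tokens are thus never regained and long runs need many
-- processes; the existential k provides them.
--
-- Only the first query is judged. If it is not `caught`, System has won whatever follows. If it is,
-- System has lost: a query never continues the chain of transitions, so the link from the test to
-- the query is broken.
--
-- Conjunction is a negated disjunction, and whether a strategy ever falls silent cannot be decided.
-- What a winning strategy yields is therefore known only up to double negation, as functions into
-- ⊥, which suffices because the goal is a refutation.
--
-- The self-reference is not circular. The program mentions only two affine maps (one more letter A
-- or B in front) and the code of the innermost letter. This fixes the alphabet and everything
-- around the prescribing subformula, and α and β are read off as offset and slope of the affine map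
-- that this surrounding part induces on codes.

nth-< : ∀ {A : Set} (l : List A) {n} {x : A} → nth l n ≡ just x → n < length l
nth-< (x ∷ l) {zero}  h = s≤s z≤n
nth-< (x ∷ l) {suc n} h = s≤s (nth-< l h)

nth-∃ : ∀ {A : Set} (l : List A) {n} → n < length l → Σ A λ x → nth l n ≡ just x
nth-∃ (x ∷ l) {zero}  _       = x , refl
nth-∃ (x ∷ l) {suc n} (s≤s p) = nth-∃ l p

nth-nothing : ∀ {A : Set} (l : List A) {n} → length l ≤ n → nth l n ≡ nothing
nth-nothing []      _       = refl
nth-nothing (x ∷ l) {suc n} (s≤s p) = nth-nothing l p

nth-nothing⁻¹ : ∀ {A : Set} (l : List A) {n} → nth l n ≡ nothing → length l ≤ n
nth-nothing⁻¹ l {n} h with n <? length l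
... | no  n≮ = ≮⇒≥ n≮
... | yes n< with nth-∃ l n<
...   | x , h′ with trans (sym h) h′
...     | ()

nth-map : ∀ {A B : Set} (f : A → B) (l : List A) n → nth (L.map f l) n ≡ M.map f (nth l n)
nth-map f []      n       = refl
nth-map f (x ∷ l) zero    = refl
nth-map f (x ∷ l) (suc n) = nth-map f l n

nth-take : ∀ {A : Set} (l : List A) {k n} → n < k → nth (take k l) n ≡ nth l n
nth-take []      {suc k} _ = refl
nth-take (x ∷ l) {suc k} {zero}  _       = refl
nth-take (x ∷ l) {suc k} {suc n} (s≤s p) = nth-take l p

nth-applyUpTo : ∀ {A : Set} (g : ℕ → A) {k n} → n < k → nth (applyUpTo g k) n ≡ just (g n)
nth-applyUpTo g {suc k} {zero}  _       = refl
nth-applyUpTo g {suc k} {suc n} (s≤s p) = nth-applyUpTo (λ i → g (suc i)) p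

take-take-≤ : ∀ {A : Set} (l : List A) {j k} → j ≤ k → take j (take k l) ≡ take j l
take-take-≤ l       {zero}          _       = refl
take-take-≤ []      {suc j} {suc k} _       = refl
take-take-≤ (x ∷ l) {suc j} {suc k} (s≤s p) = cong (x ∷_) (take-take-≤ l p)

take-applyUpTo : ∀ {A : Set} (g : ℕ → A) {j k} → j ≤ k → take j (applyUpTo g k) ≡ applyUpTo g j
take-applyUpTo g {zero}          _       = refl
take-applyUpTo g {suc j} {suc k} (s≤s p) = cong (g 0 ∷_) (take-applyUpTo (λ i → g (suc i)) p)

take-via-nth : ∀ {A : Set} (g : ℕ → A) (l : List A) k →
               (∀ {n} → n < k → nth l n ≡ just (g n)) → take k l ≡ applyUpTo g k
take-via-nth g l       zero    h = refl
take-via-nth g []      (suc k) h with h (s≤s z≤n)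
... | ()
take-via-nth g (x ∷ l) (suc k) h =
  cong₂ _∷_ (just-injective (h (s≤s z≤n))) (take-via-nth (λ i → g (suc i)) l k (λ p → h (s≤s p)))

nth-∷ʳ-old : ∀ {A : Set} (l : List A) {x n} → n < length l → nth (l ∷ʳ x) n ≡ nth l n
nth-∷ʳ-old (y ∷ l) {n = zero}  _       = refl
nth-∷ʳ-old (y ∷ l) {n = suc n} (s≤s p) = nth-∷ʳ-old l p

nth-∷ʳ-new : ∀ {A : Set} (l : List A) {x} → nth (l ∷ʳ x) (length l) ≡ just x
nth-∷ʳ-new []      = refl
nth-∷ʳ-new (y ∷ l) = nth-∷ʳ-new l

nth-∷ʳ⁻ : ∀ {A : Set} (l : List A) {x y n} → nth (l ∷ʳ x) n ≡ just y →
          (n < length l × nth l n ≡ just y) ⊎ (n ≡ length l × x ≡ y)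
nth-∷ʳ⁻ []      {n = zero}  refl = inj₂ (refl , refl)
nth-∷ʳ⁻ (z ∷ l) {n = zero}  h    = inj₁ (s≤s z≤n , h)
nth-∷ʳ⁻ (z ∷ l) {n = suc n} h    =
  Sum.map (λ (p , q) → s≤s p , q) (λ (p , q) → cong suc p , q) (nth-∷ʳ⁻ l h)

take-∷ʳ : ∀ {A : Set} (l : List A) {x k} → k ≤ length l → take k (l ∷ʳ x) ≡ take k l
take-∷ʳ l       {k = zero}  _       = refl
take-∷ʳ (y ∷ l) {k = suc k} (s≤s p) = cong (y ∷_) (take-∷ʳ l p)

-- Silent beyond the shorter list: a run is compared with the prescribed beginning before it is
-- known to be that long.
Agree : ∀ {A : Set} → List A → List A → Set
Agree as bs = ∀ n {a b} → nth as n ≡ just a → nth bs n ≡ just b → a ≡ b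

-- Serves decrements: `qs` lists the remaining holders, described as a set and by its length, which
-- is all the token invariant needs.
remove : ∀ {A : Set} {p : A} {ps} → p ∈ ps → Unique ps →
         Σ (List A) λ qs → length ps ≡ suc (length qs) × Unique qs ×
           (∀ {q} → q ∈ qs → q ∈ ps × q ≢ p) × (∀ {q} → q ∈ ps → q ≡ p ⊎ q ∈ qs)
remove {p = p} {_ ∷ ps} (here refl) (p∉ ∷ u) =
  ps , refl , u , (λ q∈ → there q∈ , λ q≡p → All.lookup p∉ q∈ (sym q≡p)) ,
  λ { (here refl) → inj₁ refl ; (there q∈) → inj₂ q∈ }
remove {p = p} {p′ ∷ ps} (there p∈) (p′∉ ∷ u) with remove p∈ u
... | qs , len , uq , sub , sup =
  p′ ∷ qs , cong suc len , All.tabulate (λ q∈ → All.lookup p′∉ (proj₁ (sub q∈))) ∷ uq ,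
  (λ { (here refl) → here refl , All.lookup p′∉ p∈
     ; (there q∈)  → there (proj₁ (sub q∈)) , proj₂ (sub q∈) }) ,
  λ { (here refl) → inj₂ (here refl) ; (there q∈) → Sum.map₂ there (sup q∈) }

-- Counter systems whose transitions are the actions of the game

data Tag : Set where
  up down test skip stop query : Tag

tagIndex : Tag → ℕ
tagIndex up    = 0
tagIndex down  = 1
tagIndex test  = 2
tagIndex skip  = 3
tagIndex stop  = 4
tagIndex query = 5

tagIndex-injective : ∀ t u → tagIndex t ≡ tagIndex u → t ≡ u
tagIndex-injective up    up    refl = refl
tagIndex-injective down  down  refl = refl
tagIndex-injective test  test  refl = refl
tagIndex-injective skip  skip  refl = refl
tagIndex-injective stop  stop  refl = refl
tagIndex-injective query query refl = refl

_≟ᵗ_ : (t u : Tag) → Dec (t ≡ u)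
t ≟ᵗ u = map′ (tagIndex-injective t u) (cong tagIndex) (tagIndex t ≟ tagIndex u)

isSystem : Tag → Bool
isSystem query = false
isSystem _     = true

record Rule (r : ℕ) : Set where
  constructor mkRule
  field
    src : ℕ
    tag : Tag
    ctr : Fin r
    tgt : ℕ

open Rule

-- `stop` and `query` have no constructor, so a run can move through neither.
data Effect {r} : Tag → Fin r → Vec ℕ r → Vec ℕ r → Set where
  up   : ∀ {c v} → Effect up c v (v [ c ]≔ suc (lookup v c))
  down : ∀ {c v m} → lookup v c ≡ suc m → Effect down c v (v [ c ]≔ m)
  test : ∀ {c v} → lookup v c ≡ 0 → Effect test c v v
  skip : ∀ {c v} → Effect skip c v v

data Run {r nA} (rule : Fin nA → Rule r) : ℕ → Vec ℕ r → List (Fin nA) → Set where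
  stop : ∀ {q v a} → src (rule a) ≡ q → tag (rule a) ≡ stop → Run rule q v (a ∷ [])
  move : ∀ {q v v′ a as} → src (rule a) ≡ q → Effect (tag (rule a)) (ctr (rule a)) v v′ →
         Run rule (tgt (rule a)) v′ as → Run rule q v (a ∷ as)

run-linked : ∀ {r nA} {rule : Fin nA → Rule r} {q v as} → Run rule q v as →
             ∀ n {a b} → nth as n ≡ just a → nth as (suc n) ≡ just b → tgt (rule a) ≡ src (rule b)
run-linked (stop _ _) zero refl ()
run-linked (stop _ _) (suc n) ()
run-linked (move _ _ (stop p _))   zero    refl refl = sym p
run-linked (move _ _ (move p _ _)) zero    refl refl = sym p
run-linked (move _ _ ρ)            (suc n) h    h′   = run-linked ρ n h h′

run-stops : ∀ {r nA} {rule : Fin nA → Rule r} {q v as} → Run rule q v as →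
            Σ ℕ λ n → Σ (Fin nA) λ a → nth as n ≡ just a × tag (rule a) ≡ stop
run-stops (stop _ t)   = 0 , _ , refl , t
run-stops (move _ _ ρ) with run-stops ρ
... | n , a , h , t = suc n , a , h , t

-- The formula

and : ∀ {n} → Form n → Form n → Form n
and φ ψ = neg (or (neg φ) (neg ψ))

x y : Var
x = zero
y = suc zero

disj : ∀ {n} → List (Fin n × Fin n) → Form n
disj []              = lt x x
disj ((a , b) ∷ abs) = or (and (act a x) (act b y)) (disj abs)

-- Any decidable condition on two letters becomes a formula because the alphabet is finite; states,
-- tags and counters need not exist in the logic.
rel : ∀ {n} {P : Fin n → Fin n → Set} → (∀ a b → Dec (P a b)) → Form n
rel {n} P? = disj (L.filter (λ ab → P? (proj₁ ab) (proj₂ ab)) (L.cartesianProduct (L.allFin n) (L.allFin n)))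

module Formula {r nA : ℕ} (rule : Fin nA → Rule r) where

  tagOf : Fin nA → Tag
  tagOf a = tag (rule a)

  Match : Tag → Tag → Fin nA → Fin nA → Set
  Match t u a b = tagOf a ≡ t × tagOf b ≡ u × ctr (rule a) ≡ ctr (rule b)

  match? : ∀ t u a b → Dec (Match t u a b)
  match? t u a b = (tagOf a ≟ᵗ t) ×-dec (tagOf b ≟ᵗ u) ×-dec (ctr (rule a) F.≟ ctr (rule b))

  Linked : Fin nA → Fin nA → Set
  Linked a b = tgt (rule a) ≡ src (rule b) × isSystem (tagOf b) ≡ true

  unlinked? : ∀ a b → Dec (¬ Linked a b)
  unlinked? a b = ¬? ((tgt (rule a) ≟ src (rule b)) ×-dec (isSystem (tagOf b) B.≟ true))

  -- `rel` wants a position for y too; x itself can be the witness.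
  has : Tag → Form nA
  has t = ex y (rel (λ a _ → tagOf a ≟ᵗ t))

  earlier : Tag → Tag → Form nA
  earlier t u = ex y (and (lt y x) (and (sim x y) (rel (match? t u))))

  -- Test, increment and decrement are each compared with x alone, never with one another: the
  -- letter of x already names the counter, and y is requantified.
  caught : Form nA
  caught = and (ex y (and (succ y x) (rel (match? query test))))
               (and (earlier query up) (neg (earlier query down)))

  failedQuery : Form nA
  failedQuery =
    ex x (and (has query)
              (and (neg (ex y (and (lt y x) (rel (λ _ b → tagOf b ≟ᵗ query))))) (neg caught)))

  brokenLink : Form nA
  brokenLink = ex x (ex y (and (succ x y) (rel unlinked?)))

  repeated : Tag → Form nA
  repeated t = ex x (earlier t t)

  unmatched : Form nA
  unmatched = ex x (and (has down) (neg (earlier down up)))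

  unfinished : Form nA
  unfinished = neg (ex x (has stop))

  violation : Form nA
  violation = or brokenLink (or (repeated up) (or (repeated down) (or unmatched unfinished)))

  -- `eq x y` hands the next position back to x, so two names spell words of any length. Each letter
  -- wraps one fixed layer around the rest, which makes the code an iterated affine map.
  reads : List (Fin nA) → Fin nA → Form nA
  reads []       b = act b x
  reads (a ∷ as) b = and (act a x) (ex y (and (succ x y) (ex x (and (eq x y) (reads as b)))))

  startsWith : List (Fin nA) → Fin nA → Form nA
  startsWith as b = ex x (and (neg (ex y (lt y x))) (reads as b))

  -- The two outer quantifiers bind nothing; they make the formula a sentence
  -- whatever its (large) disjunctions are.
  spec : List (Fin nA) → Fin nA → Form nA
  spec as b = ex x (ex y (or failedQuery (neg (or violation (neg (startsWith as b))))))

and-intro : ∀ {A B : Set} → A → B → ¬ (¬ A ⊎ ¬ B)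
and-intro a b (inj₁ ¬a) = ¬a a
and-intro a b (inj₂ ¬b) = ¬b b

-- The components of an encoded conjunction are available only while proving ⊥; all eliminators
-- below inherit this continuation form.
and-elim : ∀ {A B : Set} → ¬ (¬ A ⊎ ¬ B) → (A → B → ⊥) → ⊥
and-elim h k = h (inj₁ λ a → h (inj₂ λ b → k a b))

-- Executions indexed by natural numbers.

module Semantics {r nA : ℕ} (rule : Fin nA → Rule r) (sysAct : Fin nA → Bool)
                 (sysAct-spec : ∀ a → sysAct a ≡ isSystem (tag (rule a))) (k : ℕ) where

  open Formula rule public
  open Sem nA sysAct 0 0 k public

  tg : Event → Tag
  tg σ = tagOf (action σ)

  ct : Event → Fin r
  ct σ = ctr (rule (action σ))

  -- A partial lookup lets one argument serve finite and infinite executions.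
  at : Exec → ℕ → Maybe Event
  at (inj₁ l) n = nth l n
  at (inj₂ g) n = just (g n)

  pre : Exec → ℕ → List Event
  pre (inj₁ l) n = take n l
  pre (inj₂ g) n = applyUpTo g n

  prefix-pre : ∀ w i → prefix w i ≡ pre w (pos w i)
  prefix-pre (inj₁ l) i = refl
  prefix-pre (inj₂ g) i = refl

  at-letter : ∀ w i → at w (pos w i) ≡ just (letter w i)
  at-letter (inj₁ l) i = go l i
    where
      go : ∀ l (i : Fin (length l)) → nth l (toℕ i) ≡ just (L.lookup l i)
      go (σ ∷ l) zero    = refl
      go (σ ∷ l) (suc i) = go l i
  at-letter (inj₂ g) i = refl

  position : ∀ w {n σ} → at w n ≡ just σ → Σ (Pos w) λ i → pos w i ≡ n × letter w i ≡ σ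
  position (inj₁ l) {n} h = go l n h
    where
      go : ∀ l n {σ} → nth l n ≡ just σ → Σ (Fin (length l)) λ i → toℕ i ≡ n × L.lookup l i ≡ σ
      go (τ ∷ l) zero    refl = zero , refl , refl
      go (τ ∷ l) (suc n) h    with go l n h
      ... | i , p , q = suc i , cong suc p , q
  position (inj₂ g) {n} h = n , refl , just-injective h

  length-pre : ∀ w {n σ} → at w n ≡ just σ → length (pre w n) ≡ n
  length-pre (inj₁ l) {n} h = trans (LP.length-take n l) (m≤n⇒m⊓n≡m (<⇒≤ (nth-< l h)))
  length-pre (inj₂ g) {n} _ = LP.length-applyUpTo g n

  at-pre : ∀ w {n m} → m < n → nth (pre w n) m ≡ at w m
  at-pre (inj₁ l) p = nth-take l p
  at-pre (inj₂ g) p = nth-applyUpTo g p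

  pre-pre : ∀ w {n m} → m ≤ n → take m (pre w n) ≡ pre w m
  pre-pre (inj₁ l) p = take-take-≤ l p
  pre-pre (inj₂ g) p = take-applyUpTo g p

  at-earlier : ∀ w {n m σ} → at w n ≡ just σ → m ≤ n → Σ Event λ τ → at w m ≡ just τ
  at-earlier (inj₁ l) h p = nth-∃ l (≤-<-trans p (nth-< l h))
  at-earlier (inj₂ g) h p = _ , refl

  owner : ∀ {w} → U w → Proc
  owner     (inj₁ p) = p
  owner {w} (inj₂ i) = proc (letter w i)

  -- Each generator of the least equivalence preserves the owner, and equality of owners is an
  -- equivalence.
  sim-owner : ∀ {w u v} → Sim w u v → owner u ≡ owner v
  sim-owner (gen-pi p i h)  = h
  sim-owner (gen-ij i j h)  = h
  sim-owner sim-refl        = refl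
  sim-owner (sim-sym h)     = sym (sim-owner h)
  sim-owner (sim-trans h k) = trans (sim-owner h) (sim-owner k)

  Before : Exec → ℕ → Event → Set
  Before w n τ = Σ ℕ λ m → m < n × at w m ≡ just τ

  -- Truth of the subformulas in an execution

  module _ {w : Exec} where

    private
      A : Pos w → Fin nA
      A i = action (letter w i)

    disj-intro : ∀ {ρ : Env w} {i j} → ρ x ≡ just (inj₂ i) → ρ y ≡ just (inj₂ j) →
                 ∀ abs → (A i , A j) ∈ abs → ⟦ disj abs ⟧ ρ
    disj-intro {ρ} p q (_ ∷ abs) (here refl) =
      inj₁ (and-intro (subst (lift₁ {w} _) (sym p) refl) (subst (lift₁ {w} _) (sym q) refl))
    disj-intro p q (_ ∷ abs) (there h)   = inj₂ (disj-intro p q abs h)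

    acts-elim : ∀ {a b} (u v : Maybe (U w)) → lift₁ {w} (HasAct w a) u → lift₁ {w} (HasAct w b) v →
                Σ (Pos w) λ i → Σ (Pos w) λ j →
                  u ≡ just (inj₂ i) × v ≡ just (inj₂ j) × (A i , A j) ≡ (a , b)
    acts-elim (just (inj₂ i)) (just (inj₂ j)) refl refl = i , j , refl , refl , refl

    disj-elim : ∀ {ρ : Env w} abs → ⟦ disj abs ⟧ ρ →
                (∀ i j → ρ x ≡ just (inj₂ i) → ρ y ≡ just (inj₂ j) → (A i , A j) ∈ abs → ⊥) → ⊥
    disj-elim {ρ} [] h K with ρ x
    ... | just (inj₂ i) = <-irrefl refl h
    disj-elim {ρ} (_ ∷ abs) (inj₁ h) K = and-elim h λ hx hy →
      let i , j , p , q , m = acts-elim (ρ x) (ρ y) hx hy in K i j p q (here m)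
    disj-elim (_ ∷ abs) (inj₂ h) K = disj-elim abs h λ i j p q m → K i j p q (there m)

    rel-intro : ∀ {P : Fin nA → Fin nA → Set} (P? : ∀ a b → Dec (P a b)) {ρ : Env w} {i j} →
                ρ x ≡ just (inj₂ i) → ρ y ≡ just (inj₂ j) → P (A i) (A j) → ⟦ rel P? ⟧ ρ
    rel-intro P? {i = i} {j} p q h =
      disj-intro p q _ (∈-filter⁺ (λ ab → P? (proj₁ ab) (proj₂ ab))
                          (∈-cartesianProduct⁺ (∈-allFin (A i)) (∈-allFin (A j))) h)

    rel-elim : ∀ {P : Fin nA → Fin nA → Set} (P? : ∀ a b → Dec (P a b)) {ρ : Env w} → ⟦ rel P? ⟧ ρ →
               (∀ i j → ρ x ≡ just (inj₂ i) → ρ y ≡ just (inj₂ j) → P (A i) (A j) → ⊥) → ⊥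
    rel-elim P? h K = disj-elim _ h λ i j p q m →
      K i j p q (proj₂ (∈-filter⁻ (λ ab → P? (proj₁ ab) (proj₂ ab))
                          {xs = L.cartesianProduct (L.allFin nA) (L.allFin nA)} m))

  Does : Tag → Fin r → Proc → Event → Set
  Does t c p τ = tg τ ≡ t × ct τ ≡ c × proc τ ≡ p

  module _ {w : Exec} where

    has-intro : ∀ (ρ : Env w) {i t} → tg (letter w i) ≡ t → ⟦ has t ⟧ (update ρ x (inj₂ i))
    has-intro ρ {i} h = inj₂ i , rel-intro (λ a _ → tagOf a ≟ᵗ _) refl refl h

    has-elim : ∀ (ρ : Env w) {u t} → ⟦ has t ⟧ (update ρ x u) →
               (∀ i → u ≡ inj₂ i → tg (letter w i) ≡ t → ⊥) → ⊥
    has-elim ρ (_ , h) K = rel-elim (λ a _ → tagOf a ≟ᵗ _) h λ i j p q t → K i (just-injective p) t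

    earlier-intro : ∀ (ρ : Env w) {t u i j} → pos w j < pos w i →
                    proc (letter w i) ≡ proc (letter w j) →
                    Match t u (action (letter w i)) (action (letter w j)) →
                    ⟦ earlier t u ⟧ (update ρ x (inj₂ i))
    earlier-intro ρ {i = i} {j} j<i p m =
      inj₂ j , and-intro j<i (and-intro (gen-ij i j p) (rel-intro (match? _ _) refl refl m))

    earlier-elim : ∀ (ρ : Env w) {t u v} → ⟦ earlier t u ⟧ (update ρ x v) →
                   (∀ i j → v ≡ inj₂ i → pos w j < pos w i → proc (letter w i) ≡ proc (letter w j) →
                    Match t u (action (letter w i)) (action (letter w j)) → ⊥) → ⊥
    earlier-elim ρ (_ , h) K = and-elim h λ l h′ → and-elim h′ λ m h″ →
      rel-elim (match? _ _) h″ λ { i j refl refl t → K i j refl l (sim-owner m) t }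

    link-intro : ∀ (ρ : Env w) {n σ τ} → at w n ≡ just σ → at w (suc n) ≡ just τ →
                 ¬ Linked (action σ) (action τ) → ⟦ brokenLink ⟧ ρ
    link-intro ρ hσ hτ l with position w hσ | position w hτ
    ... | i , refl , refl | j , j≡ , refl =
      inj₂ i , inj₂ j , and-intro (sym j≡) (rel-intro unlinked? refl refl l)

    link-elim : ∀ (ρ : Env w) → ⟦ brokenLink ⟧ ρ →
                (∀ n {σ τ} → at w n ≡ just σ → at w (suc n) ≡ just τ →
                 Linked (action σ) (action τ)) → ⊥
    link-elim ρ (_ , _ , h) K = and-elim h λ s≡ h′ → rel-elim unlinked? h′ λ { i j refl refl l →
      l (K (pos w i) (at-letter w i) (trans (cong (at w) s≡) (at-letter w j))) }

    repeated-intro : ∀ (ρ : Env w) {t n σ τ} → at w n ≡ just σ → Before w n τ → tg σ ≡ t →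
                     Does t (ct σ) (proc σ) τ → ⟦ repeated t ⟧ ρ
    repeated-intro ρ hσ (m , m<n , hτ) tσ (tτ , c≡ , p≡) with position w hσ | position w hτ
    ... | i , refl , refl | j , refl , refl =
      inj₂ i , earlier-intro ρ m<n (sym p≡) (tσ , tτ , sym c≡)

    repeated-elim : ∀ (ρ : Env w) {t} → ⟦ repeated t ⟧ ρ →
                    (∀ n {σ τ} → at w n ≡ just σ → tg σ ≡ t → Before w n τ →
                     Does t (ct σ) (proc σ) τ → ⊥) → ⊥
    repeated-elim ρ (_ , h) K = earlier-elim ρ h λ { i j refl j<i p (tσ , tτ , c≡) →
      K (pos w i) (at-letter w i) tσ (pos w j , j<i , at-letter w j) (tτ , sym c≡ , sym p) }

    unmatched-intro : ∀ (ρ : Env w) {n σ} → at w n ≡ just σ → tg σ ≡ down →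
                      (∀ τ → Before w n τ → ¬ Does up (ct σ) (proc σ) τ) → ⟦ unmatched ⟧ ρ
    unmatched-intro ρ hσ tσ K with position w hσ
    ... | i , refl , refl =
      inj₂ i , and-intro (has-intro ρ tσ) λ h → earlier-elim ρ h λ { i′ j refl j<i p (_ , tτ , c≡) →
        K _ (pos w j , j<i , at-letter w j) (tτ , sym c≡ , sym p) }

    unmatched-elim : ∀ (ρ : Env w) → ⟦ unmatched ⟧ ρ →
                     (∀ n {σ} → at w n ≡ just σ → tg σ ≡ down →
                      Σ Event λ τ → Before w n τ × Does up (ct σ) (proc σ) τ) → ⊥
    unmatched-elim ρ (_ , h) K = and-elim h λ hd ne → has-elim ρ hd λ { i refl tσ →
      let τ , (m , m<n , hτ) , tτ , c≡ , p≡ = K (pos w i) (at-letter w i) tσ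
          j , j≡ , l≡ = position w hτ
      in ne (earlier-intro ρ (subst (_< pos w i) (sym j≡) m<n)
               (trans (sym p≡) (cong proc (sym l≡)))
               (tσ , trans (cong tg l≡) tτ , trans (sym c≡) (cong ct (sym l≡)))) }

    unfinished-intro : ∀ (ρ : Env w) → (∀ n {σ} → at w n ≡ just σ → tg σ ≢ stop) → ⟦ unfinished ⟧ ρ
    unfinished-intro ρ K (_ , h) = has-elim ρ h λ { i refl tσ → K (pos w i) (at-letter w i) tσ }

    unfinished-elim : ∀ (ρ : Env w) {n σ} → at w n ≡ just σ → tg σ ≡ stop → ¬ ⟦ unfinished ⟧ ρ
    unfinished-elim ρ hσ tσ h with position w hσ
    ... | i , refl , refl = h (inj₂ i , has-intro ρ tσ)

    caught-intro : ∀ (ρ : Env w) {n i σ} → pos w i ≡ suc n → at w n ≡ just σ →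
                   Match query test (action (letter w i)) (action σ) →
                   (Σ Event λ τ → Before w (suc n) τ × Does up (ct σ) (proc (letter w i)) τ) →
                   (∀ τ → Before w (suc n) τ → ¬ Does down (ct σ) (proc (letter w i)) τ) →
                   ⟦ caught ⟧ (update ρ x (inj₂ i))
    caught-intro ρ {i = i} i≡ hσ m (τ , (m′ , m<n , hτ) , tτ , c≡ , p≡) K
      with position w hσ | position w hτ
    ... | j , refl , refl | j′ , refl , refl =
      and-intro (inj₂ j , and-intro (sym i≡) (rel-intro (match? _ _) refl refl m))
        (and-intro
          (earlier-intro ρ (subst (_ <_) (sym i≡) m<n) (sym p≡)
            (proj₁ m , tτ , trans (proj₂ (proj₂ m)) (sym c≡)))
          λ h → earlier-elim ρ h λ { _ j″ refl j<i p (_ , td , c≡′) →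
            K _ (pos w j″ , subst (_ <_) i≡ j<i , at-letter w j″)
              (td , trans (sym c≡′) (proj₂ (proj₂ m)) , sym p) })

    caught-elim : ∀ (ρ : Env w) {u} → ⟦ caught ⟧ (update ρ x u) →
                  (∀ i n {σ τ} → u ≡ inj₂ i → pos w i ≡ suc n → at w n ≡ just σ → tg σ ≡ test →
                   Before w (suc n) τ → Does up (ct σ) (proc (letter w i)) τ →
                   Σ Event λ τ′ → Before w (suc n) τ′ × Does down (ct σ) (proc (letter w i)) τ′) → ⊥
    caught-elim ρ h K = and-elim h λ { (_ , h₁) h₂ → and-elim h₁ λ s≡ h₃ →
      rel-elim (match? _ _) h₃ λ { i j refl refl (tq , tt′ , cσ) → and-elim h₂ λ eu ne →
        earlier-elim ρ eu λ { _ j′ refl j<i p (_ , tu , cu) →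
          let τ′ , (m , m<n , hτ′) , td , cd , pd =
                K i (pos w j) refl (sym s≡) (at-letter w j) tt′
                  (pos w j′ , subst (_ <_) (sym s≡) j<i , at-letter w j′)
                  (tu , trans (sym cu) cσ , sym p)
              j″ , j≡ , l≡ = position w hτ′
          in ne (earlier-intro ρ (subst₂ _<_ (sym j≡) s≡ m<n)
                   (trans (sym pd) (cong proc (sym l≡)))
                   (tq , trans (cong tg l≡) td , trans cσ (trans (sym cd) (cong ct (sym l≡))))) } } }

    reads-elim : ∀ as b (ρ : Env w) {i} → ⟦ reads as b ⟧ (update ρ x (inj₂ i)) →
                 ∀ n {a σ} → nth (as ∷ʳ b) n ≡ just a → at w (pos w i + n) ≡ just σ →
                 ¬ ¬ action σ ≡ a
    reads-elim [] b ρ {i} refl zero refl hσ K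
      rewrite +-identityʳ (pos w i) = K (cong action (just-injective (trans (sym hσ) (at-letter w i))))
    reads-elim (a ∷ as) b ρ {i} h zero refl hσ K = and-elim h λ hd _ →
      K (trans (cong action (just-injective (trans (trans (sym hσ) (cong (at w) (+-identityʳ _))) (at-letter w i)))) hd)
    reads-elim (a ∷ as) b ρ {i} h (suc n) ha hσ K =
      and-elim h λ { _ (inj₁ p , h₁) → and-elim h₁ λ ()
                   ; _ (inj₂ j , h₁) → and-elim h₁ λ { s≡ (_ , h₂) → and-elim h₂ λ { refl h₃ →
                       reads-elim as b _ h₃ n ha
                         (trans (cong (at w) (trans (cong (_+ n) (sym s≡)) (sym (+-suc (pos w i) n)))) hσ) K } } }

    reads-intro : ∀ as b (ρ : Env w) {i} →
                  (∀ n {a} → nth (as ∷ʳ b) n ≡ just a →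
                   Σ Event λ σ → at w (pos w i + n) ≡ just σ × action σ ≡ a) →
                  ⟦ reads as b ⟧ (update ρ x (inj₂ i))
    reads-intro [] b ρ {i} K with K 0 refl
    ... | σ , hσ , refl =
      cong action (just-injective (trans (sym (at-letter w i)) (trans (cong (at w) (sym (+-identityʳ _))) hσ)))
    reads-intro (a ∷ as) b ρ {i} K = and-intro first rest
      where
        first : action (letter w i) ≡ a
        first with K 0 refl
        ... | σ , hσ , refl =
          cong action (just-injective (trans (sym (at-letter w i)) (trans (cong (at w) (sym (+-identityʳ _))) hσ)))
        next : Σ Event λ σ → at w (suc (pos w i)) ≡ just σ
        next with nth-∃ (as ∷ʳ b) {0} (subst (0 <_) (sym (LP.length-++ as)) (m≤n⇒m≤o+n (length as) (s≤s z≤n)))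
        ... | a′ , h with K 1 h
        ...   | σ , hσ , _ = σ , trans (cong (at w) (+-comm 1 (pos w i))) hσ
        rest : ⟦ ex y (and (succ x y) (ex x (and (eq x y) (reads as b)))) ⟧ (update ρ x (inj₂ i))
        rest with position w (proj₂ next)
        ... | j , j≡ , _ =
          inj₂ j , and-intro (sym j≡) (inj₂ j , and-intro refl (reads-intro as b _ λ n ha →
            let σ , hσ , a≡ = K (suc n) ha
            in σ , trans (cong (at w) (trans (cong (_+ n) j≡) (sym (+-suc (pos w i) n)))) hσ , a≡))

    startsWith-elim : ∀ as b (ρ : Env w) → ⟦ startsWith as b ⟧ ρ →
                      ∀ n {a σ} → nth (as ∷ʳ b) n ≡ just a → at w n ≡ just σ → ¬ ¬ action σ ≡ a
    startsWith-elim as b ρ (inj₁ p , h) n ha hσ K = and-elim h λ _ h′ → noProc as h′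
      where
        noProc : ∀ as → ¬ ⟦ reads as b ⟧ (update ρ x (inj₁ p))
        noProc []       ()
        noProc (a ∷ as) h = and-elim h λ ()
    startsWith-elim as b ρ (inj₂ i , h) n {σ = σ} ha hσ K = and-elim h λ fst h′ →
      reads-elim as b ρ h′ n ha (subst (λ m → at w (m + n) ≡ just σ) (sym (first fst)) hσ) K
      where
        first : ¬ (Σ (U w) λ u → Lt w u (inj₂ i)) → pos w i ≡ 0
        first ne with pos w i in i≡
        ... | zero  = refl
        ... | suc m with at-earlier w {m = 0} (at-letter w i) z≤n
        ...   | τ , hτ with position w hτ
        ...     | j , j≡ , _ = ⊥-elim (ne (inj₂ j , subst₂ _<_ (sym j≡) (sym i≡) (s≤s z≤n)))

    startsWith-intro : ∀ as b (ρ : Env w) →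
                       (∀ n {a} → nth (as ∷ʳ b) n ≡ just a →
                        Σ Event λ σ → at w n ≡ just σ × action σ ≡ a) →
                       ⟦ startsWith as b ⟧ ρ
    startsWith-intro as b ρ K with nth-∃ (as ∷ʳ b) {0} (subst (0 <_) (sym (LP.length-++ as)) (m≤n⇒m≤o+n (length as) (s≤s z≤n)))
    ... | a′ , h with K 0 h
    ...   | σ , hσ , _ with position w hσ
    ...     | i , i≡ , _ =
      inj₂ i , and-intro first (reads-intro as b ρ λ n ha →
        let τ , hτ , a≡ = K n ha in τ , trans (cong (λ m → at w (m + n)) i≡) hτ , a≡)
      where
        first : ¬ (Σ (U w) λ u → Lt w u (inj₂ i))
        first (inj₂ j , l) = n≮0 (subst (_ <_) i≡ l)

    failedQuery-elim : ∀ (ρ : Env w) → ⟦ failedQuery ⟧ ρ →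
                       (∀ i → tg (letter w i) ≡ query → ¬ ⟦ caught ⟧ (update ρ x (inj₂ i)) → ⊥) → ⊥
    failedQuery-elim ρ (_ , h) K = and-elim h λ hq h′ → and-elim h′ λ _ nc →
      has-elim ρ hq λ { i refl tq → K i tq nc }

    failedQuery-intro : ∀ (ρ : Env w) i → tg (letter w i) ≡ query →
                        (∀ τ → Before w (pos w i) τ → tg τ ≢ query) →
                        ¬ ⟦ caught ⟧ (update ρ x (inj₂ i)) → ⟦ failedQuery ⟧ ρ
    failedQuery-intro ρ i tq first nc = inj₂ i , and-intro (has-intro ρ tq) (and-intro
      (λ { (_ , h) → and-elim h λ l h′ → rel-elim (λ _ b → tagOf b ≟ᵗ query) h′ λ { _ j refl refl t →
             first _ (pos w j , l , at-letter w j) t } }) nc)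

  -- Live tokens

  -- A relation rather than a definition of `H′`, so that actual plays (`Before`) and planned ones
  -- (a disjoint sum) share the token lemmas.
  record Extends (H : Event → Set) (σ : Event) (H′ : Event → Set) : Set where
    field
      old  : ∀ {τ} → H τ → H′ τ
      new  : H′ σ
      only : ∀ {τ} → H′ τ → H τ ⊎ τ ≡ σ

  before-extends : ∀ w {n σ} → at w n ≡ just σ → Extends (Before w n) σ (Before w (suc n))
  before-extends w {n} hσ = record
    { old  = λ (m , p , h) → m , m<n⇒m<1+n p , h
    ; new  = n , n<1+n n , hσ
    ; only = λ (m , p , h) → only m p h }
    where
      only : ∀ m {τ} → m < suc n → at w m ≡ just τ → Before w n τ ⊎ τ ≡ _
      only m p h with m ≟ n
      ... | yes refl = inj₂ (just-injective (trans (sym h) hσ))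
      ... | no  m≢n  = inj₁ (m , ≤∧≢⇒< (≤-pred p) m≢n , h)

  -- `L` lists the current holders for each counter; `uniq` supports removing exactly one holder, so
  -- that lengths of lists can serve as counter values.
  record Tokens (H : Event → Set) (L : Vec (List Proc) r) : Set where
    field
      live    : ∀ {τ} → H τ → tg τ ≡ up → proc τ ∈ lookup L (ct τ) ⊎
                (Σ Event λ τ′ → H τ′ × Does down (ct τ) (proc τ) τ′)
      born    : ∀ {c p} → p ∈ lookup L c → Σ Event λ τ → H τ × Does up c p τ
      alive   : ∀ {c p τ} → p ∈ lookup L c → H τ → ¬ Does down c p τ
      uniq    : ∀ c → Unique (lookup L c)
      matched : ∀ {τ} → H τ → tg τ ≡ down → Σ Event λ τ′ → H τ′ × Does up (ct τ) (proc τ) τ′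

  open Extends
  open Tokens

  noTokens : Vec (List Proc) r
  noTokens = replicate r []

  tokens-start : ∀ {H} → (∀ {τ} → ¬ H τ) → Tokens H noTokens
  tokens-start none = record
    { live    = λ h _ → ⊥-elim (none h)
    ; born    = λ {c} p∈ → ⊥-elim (empty c p∈)
    ; alive   = λ _ h _ → none h
    ; uniq    = λ c → subst Unique (sym (VP.lookup-replicate c [])) []
    ; matched = λ h _ → ⊥-elim (none h) }
    where
      empty : ∀ c {p} → ¬ p ∈ lookup noTokens c
      empty c {p} p∈ with subst (p ∈_) (VP.lookup-replicate c []) p∈
      ... | ()

  ∈-update⁻ : ∀ (L : Vec (List Proc) r) c {l c′ q} → q ∈ lookup (L [ c ]≔ l) c′ →
              (c′ ≡ c × q ∈ l) ⊎ (c′ ≢ c × q ∈ lookup L c′)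
  ∈-update⁻ L c {l} {c′} q∈ with c′ F.≟ c
  ... | yes refl = inj₁ (refl , subst (_ ∈_) (VP.lookup∘update c L l) q∈)
  ... | no  c′≢c = inj₂ (c′≢c , subst (_ ∈_) (VP.lookup∘update′ c′≢c L l) q∈)

  ∈-update-new : ∀ (L : Vec (List Proc) r) c {l q} → q ∈ l → q ∈ lookup (L [ c ]≔ l) c
  ∈-update-new L c {l} q∈ = subst (_ ∈_) (sym (VP.lookup∘update c L l)) q∈

  ∈-update-old : ∀ (L : Vec (List Proc) r) {c l c′ q} → c′ ≢ c → q ∈ lookup L c′ →
                 q ∈ lookup (L [ c ]≔ l) c′
  ∈-update-old L {l = l} c′≢c q∈ = subst (_ ∈_) (sym (VP.lookup∘update′ c′≢c L l)) q∈

  uniq-update : ∀ (L : Vec (List Proc) r) c {l} → (∀ c → Unique (lookup L c)) → Unique l →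
                ∀ c′ → Unique (lookup (L [ c ]≔ l) c′)
  uniq-update L c {l} us u c′ with c′ F.≟ c
  ... | yes refl = subst Unique (sym (VP.lookup∘update c L l)) u
  ... | no  c′≢c = subst Unique (sym (VP.lookup∘update′ c′≢c L l)) (us c′)

  module _ {H H′ : Event → Set} {L : Vec (List Proc) r} {σ : Event}
           (T : Tokens H L) (E : Extends H σ H′) where

    tokens-up : tg σ ≡ up → (∀ {τ} → H τ → ¬ Does up (ct σ) (proc σ) τ) →
                Tokens H′ (L [ ct σ ]≔ (proc σ ∷ lookup L (ct σ)))
    tokens-up tσ fresh = record
      { live = live′ ; born = born′ ; alive = alive′ ; matched = matched′
      ; uniq = uniq-update L _ (uniq T) (All.tabulate (λ q∈ p≡ → fresh′ (subst (_∈ _) (sym p≡) q∈)) ∷ uniq T _) }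
      where
        L′ = L [ ct σ ]≔ (proc σ ∷ lookup L (ct σ))
        fresh′ : ¬ proc σ ∈ lookup L (ct σ)
        fresh′ p∈ = let _ , h , d = born T p∈ in fresh h d
        live′ : ∀ {τ} → H′ τ → tg τ ≡ up → proc τ ∈ lookup L′ (ct τ) ⊎
                (Σ Event λ τ′ → H′ τ′ × Does down (ct τ) (proc τ) τ′)
        live′ {τ} h t with only E h
        ... | inj₂ refl = inj₁ (∈-update-new L (ct σ) (here refl))
        ... | inj₁ h′ with live T h′ t
        ...   | inj₂ (τ′ , hd , d) = inj₂ (τ′ , old E hd , d)
        ...   | inj₁ p∈ with ct τ F.≟ ct σ
        ...     | no  c≢ = inj₁ (∈-update-old L c≢ p∈)
        ...     | yes c≡ = inj₁ (subst (λ c → proc τ ∈ lookup L′ c) (sym c≡)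
                             (∈-update-new L (ct σ) (there (subst (λ c → proc τ ∈ lookup L c) c≡ p∈))))
        born′ : ∀ {c p} → p ∈ lookup L′ c → Σ Event λ τ → H′ τ × Does up c p τ
        born′ p∈ with ∈-update⁻ L (ct σ) p∈
        ... | inj₁ (refl , here refl) = σ , new E , tσ , refl , refl
        ... | inj₁ (refl , there q∈)  = let τ , h , d = born T q∈ in τ , old E h , d
        ... | inj₂ (_ , q∈)           = let τ , h , d = born T q∈ in τ , old E h , d
        alive′ : ∀ {c p τ} → p ∈ lookup L′ c → H′ τ → ¬ Does down c p τ
        alive′ p∈ h d with only E h
        ... | inj₂ refl with trans (sym tσ) (proj₁ d)
        ...   | ()
        alive′ p∈ h d | inj₁ h′ with ∈-update⁻ L (ct σ) p∈
        ... | inj₁ (refl , there q∈)  = alive T q∈ h′ d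
        ... | inj₂ (_ , q∈)           = alive T q∈ h′ d
        -- An earlier decrement by the new holder would, by `matched`, come with an earlier
        -- increment, against freshness.
        ... | inj₁ (refl , here refl) with matched T h′ (proj₁ d)
        ...   | τ′ , hu , t′ , c′ , p′ = fresh hu (t′ , trans c′ (proj₁ (proj₂ d)) , trans p′ (proj₂ (proj₂ d)))
        matched′ : ∀ {τ} → H′ τ → tg τ ≡ down → Σ Event λ τ′ → H′ τ′ × Does up (ct τ) (proc τ) τ′
        matched′ h t with only E h
        ... | inj₁ h′ = let τ′ , hu , d = matched T h′ t in τ′ , old E hu , d
        ... | inj₂ refl with trans (sym tσ) t
        ...   | ()

    tokens-down : tg σ ≡ down → ∀ {l} → Unique l → proc σ ∈ lookup L (ct σ) →
                  (∀ {q} → q ∈ l → q ∈ lookup L (ct σ) × q ≢ proc σ) →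
                  (∀ {q} → q ∈ lookup L (ct σ) → q ≡ proc σ ⊎ q ∈ l) →
                  Tokens H′ (L [ ct σ ]≔ l)
    tokens-down tσ {l} u σ∈ sub sup = record
      { live = live′ ; born = born′ ; alive = alive′ ; matched = matched′
      ; uniq = uniq-update L _ (uniq T) u }
      where
        L′ = L [ ct σ ]≔ l
        live′ : ∀ {τ} → H′ τ → tg τ ≡ up → proc τ ∈ lookup L′ (ct τ) ⊎
                (Σ Event λ τ′ → H′ τ′ × Does down (ct τ) (proc τ) τ′)
        live′ {τ} h t with only E h
        ... | inj₂ refl with trans (sym tσ) t
        ...   | ()
        live′ {τ} h t | inj₁ h′ with live T h′ t
        ...   | inj₂ (τ′ , hd , d) = inj₂ (τ′ , old E hd , d)
        ...   | inj₁ p∈ with ct τ F.≟ ct σ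
        ...     | no  c≢ = inj₁ (∈-update-old L c≢ p∈)
        ...     | yes c≡ with sup (subst (λ c → proc τ ∈ lookup L c) c≡ p∈)
        ...       | inj₁ p≡ = inj₂ (σ , new E , tσ , sym c≡ , sym p≡)
        ...       | inj₂ q∈ = inj₁ (subst (λ c → proc τ ∈ lookup L′ c) (sym c≡) (∈-update-new L (ct σ) q∈))
        born′ : ∀ {c p} → p ∈ lookup L′ c → Σ Event λ τ → H′ τ × Does up c p τ
        born′ p∈ with ∈-update⁻ L (ct σ) p∈
        ... | inj₁ (refl , q∈) = let τ , h , d = born T (proj₁ (sub q∈)) in τ , old E h , d
        ... | inj₂ (_ , q∈)    = let τ , h , d = born T q∈ in τ , old E h , d
        alive′ : ∀ {c p τ} → p ∈ lookup L′ c → H′ τ → ¬ Does down c p τ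
        alive′ p∈ h d with ∈-update⁻ L (ct σ) p∈ | only E h
        ... | inj₁ (refl , q∈) | inj₁ h′   = alive T (proj₁ (sub q∈)) h′ d
        ... | inj₁ (refl , q∈) | inj₂ refl = proj₂ (sub q∈) (sym (proj₂ (proj₂ d)))
        ... | inj₂ (_ , q∈)    | inj₁ h′   = alive T q∈ h′ d
        ... | inj₂ (c≢ , q∈)   | inj₂ refl = c≢ (sym (proj₁ (proj₂ d)))
        matched′ : ∀ {τ} → H′ τ → tg τ ≡ down → Σ Event λ τ′ → H′ τ′ × Does up (ct τ) (proc τ) τ′
        matched′ h t with only E h
        ... | inj₁ h′   = let τ′ , hu , d = matched T h′ t in τ′ , old E hu , d
        ... | inj₂ refl = let τ′ , hu , d = born T σ∈ in τ′ , old E hu , d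

    tokens-other : tg σ ≢ up → tg σ ≢ down → Tokens H′ L
    tokens-other ¬up ¬down = record
      { live = live′ ; uniq = uniq T ; alive = alive′ ; matched = matched′
      ; born = λ p∈ → let τ , h , d = born T p∈ in τ , old E h , d }
      where
        live′ : ∀ {τ} → H′ τ → tg τ ≡ up → proc τ ∈ lookup L (ct τ) ⊎
                (Σ Event λ τ′ → H′ τ′ × Does down (ct τ) (proc τ) τ′)
        live′ h t with only E h
        ... | inj₂ refl = ⊥-elim (¬up t)
        ... | inj₁ h′   = Sum.map₂ (λ (τ′ , hd , d) → τ′ , old E hd , d) (live T h′ t)
        alive′ : ∀ {c p τ} → p ∈ lookup L c → H′ τ → ¬ Does down c p τ
        alive′ p∈ h d with only E h
        ... | inj₂ refl = ¬down (proj₁ d)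
        ... | inj₁ h′   = alive T p∈ h′ d
        matched′ : ∀ {τ} → H′ τ → tg τ ≡ down → Σ Event λ τ′ → H′ τ′ × Does up (ct τ) (proc τ) τ′
        matched′ h t with only E h
        ... | inj₂ refl = ⊥-elim (¬down t)
        ... | inj₁ h′   = let τ′ , hu , d = matched T h′ t in τ′ , old E hu , d

  length-up : ∀ (L : Vec (List Proc) r) c p →
              V.map length L [ c ]≔ suc (lookup (V.map length L) c) ≡
              V.map length (L [ c ]≔ (p ∷ lookup L c))
  length-up L c p = trans (cong (λ n → V.map length L [ c ]≔ suc n) (VP.lookup-map c length L))
                          (sym (VP.map-[]≔ length L c))

  tokens-test : ∀ (L : Vec (List Proc) r) c → lookup L c ≡ [] → lookup (V.map length L) c ≡ 0
  tokens-test L c h = trans (VP.lookup-map c length L) (cong length h)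

  length-down : ∀ (L : Vec (List Proc) r) c {l} → length (lookup L c) ≡ suc (length l) →
                Effect down c (V.map length L) (V.map length (L [ c ]≔ l))
  length-down L c h = subst (Effect down c (V.map length L)) (sym (VP.map-[]≔ length L c))
                        (down (trans (VP.lookup-map c length L) h))

  system-action : ∀ {a} → sysAct a ≡ true → tagOf a ≢ query
  system-action {a} h t with trans (sym h) (trans (sysAct-spec a) (cong isSystem t))
  ... | ()

  environment-action : ∀ {a} → sysAct a ≡ false → tagOf a ≡ query
  environment-action {a} h = go (tagOf a) (trans (sym (sysAct-spec a)) h)
    where
      go : ∀ t → isSystem t ≡ false → t ≡ query
      go query _ = refl

  allowed : ∀ b (p : Proc) → Allowed b (proj₁ p)
  allowed true  (se , _) = sys-se
  allowed false (se , _) = env-se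

  -- Plays that follow a strategy.

  module _ (f : Strategy) where

    Follows : Exec → Set
    Follows w = ∀ n {σ} → at w n ≡ just σ → IsSys σ → out f (pre w n) ≡ just σ

    follows⇒compatible : ∀ w → Follows w → Compatible f w
    follows⇒compatible w F i h = trans (cong (out f) (prefix-pre w i)) (F (pos w i) (at-letter w i) h)

    compatible⇒follows : ∀ w → Compatible f w → Follows w
    compatible⇒follows w C n hσ h with position w hσ
    ... | i , refl , refl = trans (cong (out f) (sym (prefix-pre w i))) (C i h)

    out-system : ∀ u {σ} → out f u ≡ just σ → IsSys σ
    out-system u h with f u
    out-system u refl | just (σ , p) = p

    follows-∷ʳ : ∀ u {σ} → Follows (inj₁ u) → (IsSys σ → out f u ≡ just σ) → Follows (inj₁ (u ∷ʳ σ))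
    follows-∷ʳ u F h n hτ hs with nth-∷ʳ⁻ u hτ
    ... | inj₁ (n< , hτ′)  = trans (cong (out f) (take-∷ʳ u (<⇒≤ n<))) (F n hτ′ hs)
    ... | inj₂ (refl , refl) =
      trans (cong (out f) (trans (take-∷ʳ u ≤-refl) (LP.take-all (length u) u ≤-refl))) (h hs)

    -- The executions in which the environment stays idle after u.
    module _ (u : List Event) (F₀ : Follows (inj₁ u)) where

      grow : List Event → Maybe Event → List Event
      grow l (just σ) = l ∷ʳ σ
      grow l nothing  = l

      iter : ℕ → List Event
      iter zero    = u
      iter (suc t) = grow (iter t) (out f (iter t))

      record Good (l : List Event) : Set where
        field
          follows : Follows (inj₁ l)
          keeps   : ∀ {n σ} → nth u n ≡ just σ → nth l n ≡ just σ
          system  : ∀ {n σ} → length u ≤ n → nth l n ≡ just σ → IsSys σ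

      open Good

      good-grow : ∀ l → Good l → Good (grow l (out f l))
      good-grow l G with out f l in eqf
      ... | nothing = G
      ... | just σ  = record
        { follows = follows-∷ʳ l (follows G) (λ _ → eqf)
        ; keeps   = λ h → trans (nth-∷ʳ-old l (nth-< l (keeps G h))) (keeps G h)
        ; system  = sys }
        where
          sys : ∀ {n τ} → length u ≤ n → nth (l ∷ʳ σ) n ≡ just τ → IsSys τ
          sys n≥ h with nth-∷ʳ⁻ l h
          ... | inj₁ (_ , h′)    = system G n≥ h′
          ... | inj₂ (_ , refl) = out-system l eqf

      good : ∀ t → Good (iter t)
      good zero    = record { follows = F₀ ; keeps = λ h → h
                            ; system = λ n≥ h → ⊥-elim (<⇒≱ (nth-< u h) n≥) }
      good (suc t) = good-grow (iter t) (good t)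

      iter-suc : ∀ t {n σ} → nth (iter t) n ≡ just σ → nth (iter (suc t)) n ≡ just σ
      iter-suc t h with out f (iter t)
      ... | nothing = h
      ... | just τ  = trans (nth-∷ʳ-old (iter t) (nth-< (iter t) h)) h

      iter-mono : ∀ {t t′} → t ≤ t′ → ∀ {n σ} → nth (iter t) n ≡ just σ → nth (iter t′) n ≡ just σ
      iter-mono {t} t≤ {n} {σ} h with m≤n⇒∃[o]m+o≡n t≤
      ... | d , refl = go d
        where
          go : ∀ d → nth (iter (t + d)) n ≡ just σ
          go zero    = subst (λ t′ → nth (iter t′) n ≡ just σ) (sym (+-identityʳ t)) h
          go (suc d) = subst (λ t′ → nth (iter t′) n ≡ just σ) (sym (+-suc t d)) (iter-suc (t + d) (go d))

      -- Either f falls silent at some stage, giving a finite fair play, or the limit of the stages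
      -- is infinite and System moves forever in it. Which case holds is undecided, hence the
      -- continuation `K`.
      idle : ((w : Exec) → Follows w → Fair f w →
              (∀ {n σ} → nth u n ≡ just σ → at w n ≡ just σ) →
              (∀ {n σ} → length u ≤ n → at w n ≡ just σ → IsSys σ) → ⊥) → ⊥
      idle K = infinite λ t h → K (inj₁ (iter t)) (follows (good t)) h (keeps (good t)) (system (good t))
        where
          infinite : (∀ t → out f (iter t) ≢ nothing) → ⊥
          infinite never = K (inj₂ g) F fair (λ h → trans (sym (g-spec {0} (nth-< u h))) h) sys
            where
              growing : ∀ t → suc (length (iter t)) ≤ length (iter (suc t))
              growing t with out f (iter t) in eqf
              ... | nothing = ⊥-elim (never t eqf)
              ... | just σ  = ≤-reflexive (trans (+-comm 1 _) (sym (LP.length-++ (iter t))))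
              long : ∀ t → t ≤ length (iter t)
              long zero    = z≤n
              long (suc t) = ≤-trans (s≤s (long t)) (growing t)
              -- Stage n + 1 has length at least n + 1, so it already contains position n.
              g : ℕ → Event
              g n = proj₁ (nth-∃ (iter (suc n)) (long (suc n)))
              g-def : ∀ n → nth (iter (suc n)) n ≡ just (g n)
              g-def n = proj₂ (nth-∃ (iter (suc n)) (long (suc n)))
              g-spec : ∀ {t n} → n < length (iter t) → nth (iter t) n ≡ just (g n)
              g-spec {t} {n} n< with nth-∃ (iter t) n< | ≤-total t (suc n)
              ... | τ , hτ | inj₁ t≤ = trans hτ (trans (sym (iter-mono t≤ hτ)) (g-def n))
              ... | τ , hτ | inj₂ t≥ = iter-mono t≥ (g-def n)
              F : Follows (inj₂ g)
              F n refl hs = trans (cong (out f) (sym prefix≡)) (follows (good (suc n)) n (g-def n) hs)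
                where
                  prefix≡ : take n (iter (suc n)) ≡ applyUpTo g n
                  prefix≡ = take-via-nth g (iter (suc n)) n λ m<n →
                    g-spec {suc n} (≤-trans (<⇒≤ (s≤s m<n)) (long (suc n)))
              sys : ∀ {n σ} → length u ≤ n → at (inj₂ g) n ≡ just σ → IsSys σ
              sys {n} n≥ refl = system (good (suc n)) n≥ (g-def n)
              fair : Fair f (inj₂ g)
              -- From `length u` on every event is System's, so the conclusion of fairness holds
              -- outright.
              fair _ n = n + length u , m≤m+n n _ , sys (m≤n+m (length u) n) refl

  -- From a winning strategy to an accepting run.

  module Soundness (queryOn : ∀ c → Σ (Fin nA) λ a → tagOf a ≡ query × ctr (rule a) ≡ c)
                   {as b} (f : Strategy) (win : Winning f (spec as b)) where

    -- If System tests for zero while p still holds a token, Environment wins by querying p at once.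
    challenge : ∀ w → Follows f w → (∀ {n σ} → at w n ≡ just σ → IsSys σ) →
                ∀ {n σ p} → at w n ≡ just σ → tg σ ≡ test →
                (Σ Event λ τ → Before w n τ × Does up (ct σ) p τ) →
                (∀ {τ} → Before w n τ → ¬ Does down (ct σ) p τ) → ⊥
    challenge w F sys {n} {σ} {p} hσ tσ (τ , (m , m<n , hτ) , d) nodown =
      -- Environment queries once and then stays idle, so a fair continuation exists to which `win`
      -- applies.
      idle f u F-u λ w′ F′ fair keep sys′ →
        lost w′ keep sys′ (win w′ (follows⇒compatible f w′ F′) fair)
      where
        a : Fin nA
        a = proj₁ (queryOn (ct σ))
        ta : tagOf a ≡ query
        ta = proj₁ (proj₂ (queryOn (ct σ)))
        ca : ctr (rule a) ≡ ct σ
        ca = proj₂ (proj₂ (queryOn (ct σ)))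
        ε : Event
        ε = a , p , allowed (sysAct a) p
        u₀ : List Event
        u₀ = pre w (suc n)
        u : List Event
        u = u₀ ∷ʳ ε
        len₀ : length u₀ ≡ suc n
        len₀ = ≤-antisym (upper w) lower
          where
            upper : ∀ w → length (pre w (suc n)) ≤ suc n
            upper (inj₁ l) = ≤-trans (≤-reflexive (LP.length-take (suc n) l)) (m⊓n≤m (suc n) _)
            upper (inj₂ g) = ≤-reflexive (LP.length-applyUpTo g (suc n))
            lower : suc n ≤ length u₀
            lower = nth-< u₀ (trans (at-pre w (n<1+n n)) hσ)
        len : length u ≡ suc (suc n)
        len = trans (LP.length-++ u₀) (trans (+-comm _ 1) (cong suc len₀))
        F-u₀ : Follows f (inj₁ u₀)
        F-u₀ j h hs = trans (cong (out f) (pre-pre w (<⇒≤ j<)))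
                        (F j (trans (sym (at-pre w j<)) h) hs)
          where
            j< : j < suc n
            j< = subst (j <_) len₀ (nth-< u₀ h)
        F-u : Follows f (inj₁ u)
        F-u = follows-∷ʳ f u₀ F-u₀ λ hs → ⊥-elim (system-action hs ta)
        u-old : ∀ {j} → j < suc n → nth u j ≡ at w j
        u-old j< = trans (nth-∷ʳ-old u₀ (subst (_ <_) (sym len₀) j<)) (at-pre w j<)
        u-new : nth u (suc n) ≡ just ε
        u-new = subst (λ j → nth u j ≡ just ε) len₀ (nth-∷ʳ-new u₀)
        lost : ∀ w′ → (∀ {n σ} → nth u n ≡ just σ → at w′ n ≡ just σ) →
               (∀ {n σ} → length u ≤ n → at w′ n ≡ just σ → IsSys σ) → ¬ Models w′ (spec as b)
        -- The inserted event is the only query in `w′`, and it is caught.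
        lost w′ keep sys′ (_ , _ , inj₁ h) = failedQuery-elim _ h found
          where
            w′-old : ∀ {j} → j < suc n → at w′ j ≡ at w j
            w′-old {j} j< with at-earlier w hσ (≤-pred j<)
            ... | τ , hτ = trans (keep (trans (u-old j<) hτ)) (sym hτ)
            found : ∀ i → tg (letter w′ i) ≡ query → ¬ ⟦ caught ⟧ (update _ x (inj₂ i)) → ⊥
            found i tq nc with <-cmp (pos w′ i) (suc n)
            ... | tri< i< _ _ = system-action (sys (trans (sym (w′-old i<)) (at-letter w′ i))) tq
            ... | tri> _ _ i> = system-action (sys′ (subst (_≤ _) (sym len) i>) (at-letter w′ i)) tq
            ... | tri≈ _ i≡ _ = nc (caught-intro _ i≡ (trans (w′-old (n<1+n n)) hσ)
                    (tq , tσ , trans (cong ct letter≡) ca)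
                    (τ , (m , m<n⇒m<1+n m<n , trans (w′-old (m<n⇒m<1+n m<n)) hτ) ,
                       subst (λ q → Does up (ct σ) q τ) (sym (cong proc letter≡)) d)
                    λ τ′ (j , j< , h′) d′ → nodown′ j j< (trans (sym (w′-old j<)) h′)
                      (subst (λ q → Does down (ct σ) q τ′) (cong proc letter≡) d′))
              where
                letter≡ : letter w′ i ≡ ε
                letter≡ = just-injective (trans (sym (at-letter w′ i)) (trans (cong (at w′) i≡) (keep u-new)))
                nodown′ : ∀ j {τ} → j < suc n → at w j ≡ just τ → ¬ Does down (ct σ) p τ
                nodown′ j j< h d with only (before-extends w hσ) (j , j< , h)
                ... | inj₁ h′ = nodown h′ d
                ... | inj₂ refl with trans (sym tσ) (proj₁ d)
                ...   | ()
        lost w′ keep sys′ (_ , _ , inj₂ h) =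
          h (inj₁ (inj₁ (link-intro _ (keep (trans (u-old (n<1+n n)) hσ)) (keep u-new)
            λ (_ , s≡) → contra (trans (sym s≡) (cong isSystem ta)))))
          where
            contra : true ≢ false
            contra ()

    -- Against an idle Environment no query occurs, so the second disjunct of `spec` must hold, and
    -- the absence of violations lets the play be read as a run. The initial state may stay open,
    -- since the prescribed letters determine the later ones.
    accepted : ¬ ¬ (Σ ℕ λ q → Σ (List (Fin nA)) λ bs →
                    Run rule q (V.map length noTokens) bs × Agree bs (as ∷ʳ b))
    accepted K = idle f [] (λ _ ()) λ w F fair _ sys →
      follow w F (sys z≤n) (win w (follows⇒compatible f w F) fair)
      where
        follow : ∀ w → Follows f w → (∀ {n σ} → at w n ≡ just σ → IsSys σ) → ¬ Models w (spec as b)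
        follow w F sys (_ , _ , inj₁ h) = failedQuery-elim _ h λ i tq _ →
          system-action (sys (at-letter w i)) tq
        follow w F sys (u , u′ , inj₂ h) =
          -- Proving that no stop letter occurs would produce a violation; hence `trace` may assume
          -- one and has to reach ⊥.
          clean (inj₂ (inj₂ (inj₂ (inj₂ (unfinished-intro ρ λ _ → trace)))))
          where
            ρ : Env w
            ρ = update (update (λ _ → nothing) x u) y u′
            clean : ¬ ⟦ violation ⟧ ρ
            clean v = h (inj₁ v)
            linked : ∀ {n σ τ} → at w n ≡ just σ → at w (suc n) ≡ just τ →
                     src (rule (action τ)) ≡ tgt (rule (action σ))
            linked hσ hτ = sym (decidable-stable (_ ≟ _) λ t≢ →
              clean (inj₁ (link-intro ρ hσ hτ λ l → t≢ (proj₁ l))))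
            once : ∀ {n σ τ t} → t ≡ up ⊎ t ≡ down → at w n ≡ just σ → Before w n τ → tg σ ≡ t →
                   ¬ Does t (ct σ) (proc σ) τ
            once (inj₁ refl) hσ hτ tσ d = clean (inj₂ (inj₁ (repeated-intro ρ hσ hτ tσ d)))
            once (inj₂ refl) hσ hτ tσ d = clean (inj₂ (inj₂ (inj₁ (repeated-intro ρ hσ hτ tσ d))))
            advance : ∀ {n σ L} → at w n ≡ just σ → Tokens (Before w n) L →
                      (tg σ ≢ stop → ∀ L′ → Effect (tg σ) (ct σ) (V.map length L) (V.map length L′) →
                       Tokens (Before w (suc n)) L′ → ⊥) →
                      (tg σ ≡ stop → ⊥) → ⊥
            advance {n} {σ} {L} hσ T K₁ K₂ = dispatch (tg σ) refl
              where
                E = before-extends w hσ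
                continue : ∀ {t} → tg σ ≡ t → t ≢ stop → ∀ {L′} →
                           Effect t (ct σ) (V.map length L) (V.map length L′) →
                           Tokens (Before w (suc n)) L′ → ⊥
                continue refl t≢ ε T′ = K₁ t≢ _ ε T′
                neutral : ∀ {t} → tg σ ≡ t → t ≢ up → t ≢ down → Tokens (Before w (suc n)) L
                neutral refl ¬up ¬down = tokens-other T E ¬up ¬down
                dispatch : ∀ t → tg σ ≡ t → ⊥
                dispatch up tσ = continue tσ (λ ())
                  (subst (Effect up (ct σ) _) (length-up L (ct σ) (proc σ)) up)
                  (tokens-up T E tσ λ hτ → once (inj₁ refl) hσ hτ tσ)
                -- Without an earlier increment by this process `unmatched` would hold, so one may
                -- be assumed. Its token is still live, as otherwise this decrement would be a
                -- repetition.
                dispatch down tσ = clean (inj₂ (inj₂ (inj₂ (inj₁ (unmatched-intro ρ hσ tσ matching)))))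
                  where
                    matching : ∀ τ → Before w n τ → ¬ Does up (ct σ) (proc σ) τ
                    matching τ hτ (tu , c≡ , p≡) with live T hτ tu
                    ... | inj₂ (τ′ , hτ′ , t′ , c′ , p′) =
                      once (inj₂ refl) hσ hτ′ tσ (t′ , trans c′ c≡ , trans p′ p≡)
                    ... | inj₁ q∈ with subst₂ (λ q c → q ∈ lookup L c) p≡ c≡ q∈
                    ...   | p∈ with remove p∈ (uniq T (ct σ))
                    ...     | l , len , ul , sub , sup = continue tσ (λ ())
                      (length-down L (ct σ) len) (tokens-down T E tσ ul p∈ sub sup)
                -- A remaining holder is a process with which Environment could win by `challenge`.
                dispatch test tσ with lookup L (ct σ) in empty
                ... | []    = continue tσ (λ ()) (test (tokens-test L (ct σ) empty)) (neutral tσ (λ ()) (λ ()))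
                ... | p ∷ _ = challenge w F sys hσ tσ (born T p∈) (alive T p∈)
                  where
                    p∈ : p ∈ lookup L (ct σ)
                    p∈ = subst (p ∈_) (sym empty) (here refl)
                dispatch skip tσ  = continue tσ (λ ()) skip (neutral tσ (λ ()) (λ ()))
                dispatch stop tσ  = K₂ tσ
                dispatch query tσ = system-action (sys hσ) tσ
            Path : ℕ → List (Fin nA) → Set
            Path n bs = ∀ m {a} → nth bs m ≡ just a → Σ Event λ τ → at w (n + m) ≡ just τ × action τ ≡ a
            here-path : ∀ {n σ} → at w n ≡ just σ → at w (n + 0) ≡ just σ
            here-path {n} = trans (cong (at w) (+-identityʳ n))
            halt-here : ∀ {n σ} → at w n ≡ just σ → Path n (action σ ∷ [])
            halt-here hσ zero    refl = _ , here-path hσ , refl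
            halt-here hσ (suc m) ()
            module _ {N : ℕ} {ω : Event} (hω : at w N ≡ just ω) (tω : tg ω ≡ stop) where
              -- d counts the positions left up to the stop letter at N; an earlier stop letter ends
              -- the run as well.
              go : ∀ d n {σ L} → n + d ≡ N → at w n ≡ just σ → Tokens (Before w n) L →
                   (∀ bs → Run rule (src (rule (action σ))) (V.map length L) bs → Path n bs → ⊥) → ⊥
              go zero n {σ} n+d hσ T K′ = advance hσ T
                (λ t≢ _ _ _ → t≢ (trans (cong tg (just-injective
                   (trans (sym (here-path hσ)) (trans (cong (at w) n+d) hω)))) tω))
                (λ tσ → K′ (action σ ∷ []) (stop refl tσ) (halt-here hσ))
              go (suc d) n {σ} n+d hσ T K′ = advance hσ T
                (λ _ L′ ε T′ →
                  let τ , hτ = at-earlier w hω (subst (suc n ≤_) (trans (sym (+-suc n d)) n+d) (s≤s (m≤m+n n d)))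
                  in go d (suc n) (trans (sym (+-suc n d)) n+d) hτ T′ λ bs run path →
                       K′ (action σ ∷ bs) (move refl ε (subst (λ q → Run rule q (V.map length L′) bs) (linked hσ hτ) run))
                         λ { zero refl → σ , here-path hσ , refl
                           ; (suc m) ha → let τ′ , hτ′ , a≡ = path m ha
                                          in τ′ , trans (cong (at w) (+-suc n m)) hτ′ , a≡ })
                (λ tσ → K′ (action σ ∷ []) (stop refl tσ) (halt-here hσ))
              trace : ⊥
              trace with at-earlier w {m = 0} hω z≤n
              ... | σ , hσ = go N 0 refl hσ (tokens-start λ ()) λ bs run path →
                h (inj₂ λ st → K (_ , bs , run , λ n ha hb →
                  let τ , hτ , a≡ = path n ha
                  in trans (sym a≡) (decidable-stable (_ F.≟ _) (startsWith-elim as b ρ st n hb hτ))))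

  -- From an accepting run to a winning strategy.

  record Legal (H : Event → Set) (σ : Event) : Set where
    field
      legal-up   : tg σ ≡ up → ∀ {τ} → H τ → ¬ Does up (ct σ) (proc σ) τ
      legal-down : tg σ ≡ down → (Σ Event λ τ → H τ × Does up (ct σ) (proc σ) τ) ×
                   (∀ {τ} → H τ → ¬ Does down (ct σ) (proc σ) τ)
      legal-test : tg σ ≡ test → ∀ {τ p} → H τ → Does up (ct σ) p τ →
                   Σ Event λ τ′ → H τ′ × Does down (ct σ) p τ′

  open Legal

  legal-resp : ∀ {H H′ : Event → Set} {σ} → (∀ {τ} → H τ → H′ τ) → (∀ {τ} → H′ τ → H τ) →
               Legal H σ → Legal H′ σ
  legal-resp to from l = record
    { legal-up   = λ t h → legal-up l t (from h)
    ; legal-down = λ t → let (τ , h , d) , n = legal-down l t in (τ , to h , d) , λ h′ → n (from h′)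
    ; legal-test = λ t h d → let τ , h′ , d′ = legal-test l t (from h) d in τ , to h′ , d′ }

  events : List (Σ Event IsSys) → List Event
  events = L.map proj₁

  LegalFrom : (Event → Set) → List (Σ Event IsSys) → Set
  LegalFrom H es = ∀ n {σ} → nth (events es) n ≡ just σ →
                   Legal (λ τ → H τ ⊎ Before (inj₁ (events es)) n τ) σ

  legal-∷ : ∀ {H σ es} → Legal H (proj₁ σ) → LegalFrom (λ τ → H τ ⊎ τ ≡ proj₁ σ) es →
            LegalFrom H (σ ∷ es)
  legal-∷ l ls zero    refl = legal-resp inj₁ (λ { (inj₁ h) → h ; (inj₂ (_ , () , _)) }) l
  legal-∷ l ls (suc n) hτ   = legal-resp
    (λ { (inj₁ (inj₁ h))      → inj₁ h
       ; (inj₁ (inj₂ refl))   → inj₂ (0 , s≤s z≤n , refl)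
       ; (inj₂ (m , m< , h)) → inj₂ (suc m , s≤s m< , h) })
    (λ { (inj₁ h)                      → inj₁ (inj₁ h)
       ; (inj₂ (zero , _ , refl))      → inj₁ (inj₂ refl)
       ; (inj₂ (suc m , s≤s m< , h)) → inj₂ (m , m< , h) })
    (ls n hτ)

  index : Proc → ℕ
  index (_ , i) = toℕ i

  Fresh : (Event → Set) → ℕ → Set
  Fresh H j = ∀ {τ} → H τ → tg τ ≡ up → index (proc τ) < j

  Schedule : (Event → Set) → List (Fin nA) → Set
  Schedule H bs = Σ (List (Σ Event IsSys)) λ es →
    L.map (λ σ → action (proj₁ σ)) es ≡ bs × LegalFrom H es

  event : ∀ a → isSystem (tagOf a) ≡ true → Proc → Σ Event IsSys
  event a h p = (a , p , allowed (sysAct a) p) , trans (sysAct-spec a) h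

  -- The event number j is played by process j, unless it is a decrement.
  schedule : ∀ {q v bs H L} → Run rule q v bs → V.map length L ≡ v → Tokens H L →
             ∀ j → Fresh H j → j + length bs ≤ k → Schedule H bs
  schedule {H = H} {L} (stop {a = a} _ t) refl T j fr j≤ =
    σ ∷ [] , refl , legal-∷ {σ = σ} {es = []} legal λ _ ()
    where
      σ : Σ Event IsSys
      σ = event a (cong isSystem t) (se , fromℕ< (≤-trans (≤-reflexive (+-comm 1 j)) j≤))
      not : ∀ {t′} → stop ≢ t′ → tagOf a ≢ t′
      not ≢t′ h = ≢t′ (trans (sym t) h)
      legal : Legal H (proj₁ σ)
      legal = record { legal-up   = λ t′ → ⊥-elim (not (λ ()) t′)
                     ; legal-down = λ t′ → ⊥-elim (not (λ ()) t′)
                     ; legal-test = λ t′ → ⊥-elim (not (λ ()) t′) }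
  schedule {H = H} {L} (move {v′ = v′} {a = a} {as} _ ε run) refl T j fr j≤ =
    play (tagOf a) refl ε
    where
      c : Fin r
      c = ctr (rule a)
      j< : j < k
      j< = ≤-trans (s≤s (m≤m+n j (length as))) (≤-trans (≤-reflexive (sym (+-suc j (length as)))) j≤)
      cons : ∀ σ {L′} → action (proj₁ σ) ≡ a → V.map length L′ ≡ v′ → Legal H (proj₁ σ) →
             (Extends H (proj₁ σ) (λ τ → H τ ⊎ τ ≡ proj₁ σ) → Tokens (λ τ → H τ ⊎ τ ≡ proj₁ σ) L′) →
             (tg (proj₁ σ) ≡ up → index (proc (proj₁ σ)) ≡ j) → Schedule H (a ∷ as)
      cons σ refl L≡ l T′ fr′ =
        let es , es≡ , ls = schedule run L≡ (T′ record { old = inj₁ ; new = inj₂ refl ; only = λ h → h })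
                              (suc j) (λ { (inj₁ h) t → m<n⇒m<1+n (fr h t)
                                         ; (inj₂ refl) t → s≤s (≤-reflexive (fr′ t)) })
                              (≤-trans (≤-reflexive (sym (+-suc j (length as)))) j≤)
        in σ ∷ es , cong (a ∷_) es≡ , legal-∷ {σ = σ} {es = es} l ls
      play : ∀ t → tagOf a ≡ t → Effect t c (V.map length L) v′ → Schedule H (a ∷ as)
      play up tσ up = cons σ refl (sym (length-up L c (proc (proj₁ σ)))) legal
                        (λ E → tokens-up T E tσ fresh) λ _ → toℕ-fromℕ< j<
        where
          σ = event a (cong isSystem tσ) (se , fromℕ< j<)
          fresh : ∀ {τ} → H τ → ¬ Does up (ct (proj₁ σ)) (proc (proj₁ σ)) τ
          fresh h (t , _ , p≡) = <-irrefl (trans (cong index p≡) (toℕ-fromℕ< j<)) (fr h t)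
          legal : Legal H (proj₁ σ)
          legal = record { legal-up   = λ _ → fresh
                         ; legal-down = λ t → ⊥-elim (tag≢ (λ ()) t)
                         ; legal-test = λ t → ⊥-elim (tag≢ (λ ()) t) }
            where
              tag≢ : ∀ {t} → up ≢ t → tagOf a ≢ t
              tag≢ ≢t h = ≢t (trans (sym tσ) h)
      -- A decrement must be played by a holder of a token of c. The counter is positive, so the
      -- list of holders has a head.
      play down tσ (down {m = m} l≡) = token (lookup L c) refl
        where
          len : length (lookup L c) ≡ suc m
          len = trans (sym (VP.lookup-map c length L)) l≡
          tag≢ : ∀ {t} → down ≢ t → tagOf a ≢ t
          tag≢ ≢t h = ≢t (trans (sym tσ) h)
          token : ∀ l → lookup L c ≡ l → Schedule H (a ∷ as)
          token [] l≡[] with trans (sym len) (cong length l≡[])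
          ... | ()
          token (p ∷ l) l≡∷ with remove p∈ (uniq T c)
            where
              p∈ : p ∈ lookup L c
              p∈ = subst (p ∈_) (sym l≡∷) (here refl)
          ... | qs , len′ , u , sub , sup =
            cons σ refl (trans (VP.map-[]≔ length L c)
                           (cong (V.map length L [ c ]≔_) (suc-injective (trans (sym len′) len))))
              (record { legal-up   = λ t → ⊥-elim (tag≢ (λ ()) t)
                      ; legal-down = λ _ → born T p∈ , alive T p∈
                      ; legal-test = λ t → ⊥-elim (tag≢ (λ ()) t) })
              (λ E → tokens-down T E tσ u p∈ sub sup) λ t → ⊥-elim (tag≢ (λ ()) t)
            where
              σ = event a (cong isSystem tσ) p
              p∈ : p ∈ lookup L c
              p∈ = subst (p ∈_) (sym l≡∷) (here refl)
      play test tσ (test l≡) = cons (event a (cong isSystem tσ) (se , fromℕ< j<)) refl refl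
        (record { legal-up   = λ t → ⊥-elim (tag≢ (λ ()) t)
                ; legal-down = λ t → ⊥-elim (tag≢ (λ ()) t)
                ; legal-test = λ _ → gone })
        (λ E → tokens-other T E (tag≢ (λ ())) (tag≢ (λ ()))) λ t → ⊥-elim (tag≢ (λ ()) t)
        where
          tag≢ : ∀ {t} → test ≢ t → tagOf a ≢ t
          tag≢ ≢t h = ≢t (trans (sym tσ) h)
          -- Each earlier increment is still live or already decremented, and at a zero counter none
          -- is live.
          gone : ∀ {τ p} → H τ → Does up c p τ → Σ Event λ τ′ → H τ′ × Does down c p τ′
          gone h (t , c≡ , refl) with live T h t
          ... | inj₂ (τ′ , h′ , t′ , c′ , p′) = τ′ , h′ , t′ , trans c′ c≡ , p′
          ... | inj₁ p∈ = ⊥-elim (empty (lookup L c) (trans (sym (VP.lookup-map c length L)) l≡)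
                                    (subst (λ c′ → _ ∈ lookup L c′) c≡ p∈))
            where
              empty : ∀ l → length l ≡ 0 → ∀ {p} → ¬ p ∈ l
              empty [] _ ()
      play skip tσ skip = cons (event a (cong isSystem tσ) (se , fromℕ< j<)) refl refl
        (record { legal-up   = λ t → ⊥-elim (tag≢ (λ ()) t)
                ; legal-down = λ t → ⊥-elim (tag≢ (λ ()) t)
                ; legal-test = λ t → ⊥-elim (tag≢ (λ ()) t) })
        (λ E → tokens-other T E (tag≢ (λ ())) (tag≢ (λ ()))) λ t → ⊥-elim (tag≢ (λ ()) t)
        where
          tag≢ : ∀ {t} → skip ≢ t → tagOf a ≢ t
          tag≢ ≢t h = ≢t (trans (sym tσ) h)

  module Completeness {q bs as b} (run : Run rule q (V.map length noTokens) bs) (bs≤k : length bs ≤ k)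
                      (prefix≡ : ∀ n {a} → nth (as ∷ʳ b) n ≡ just a → nth bs n ≡ just a) where

    plan : Schedule (λ _ → ⊥) bs
    plan = schedule run refl (tokens-start λ h → h) 0 (λ ()) bs≤k

    es : List (Σ Event IsSys)
    es = proj₁ plan

    E : List Event
    E = events es

    -- Only the length of the history matters: the first move of Environment already makes
    -- `failedQuery` true, so System never has to react.
    strategy : Strategy
    strategy u = nth es (length u)

    strategy-out : ∀ u → out strategy u ≡ nth E (length u)
    strategy-out u = sym (nth-map proj₁ es (length u))

    actions : ∀ n → M.map action (nth E n) ≡ nth bs n
    actions n = trans (sym (nth-map action E n))
                  (cong (λ l → nth l n) (trans (sym (LP.map-∘ es)) (proj₁ (proj₂ plan))))

    action-of : ∀ {n σ} → nth E n ≡ just σ → nth bs n ≡ just (action σ)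
    action-of {n} h = trans (sym (actions n)) (cong (M.map action) h)

    event-at : ∀ {n a} → nth bs n ≡ just a → Σ Event λ σ → nth E n ≡ just σ × action σ ≡ a
    event-at {n} h with nth E n | actions n
    ... | just σ  | h′ = σ , refl , just-injective (trans h′ h)
    ... | nothing | h′ with trans h′ h
    ...   | ()

    system : ∀ {n σ} → nth E n ≡ just σ → IsSys σ
    system {n} h = out-system (λ _ → nth es n) [] (trans (sym (nth-map proj₁ es n)) h)

    legal : ∀ {n σ} → nth E n ≡ just σ → Legal (Before (inj₁ E) n) σ
    legal {n} h = legal-resp (λ { (inj₁ ()) ; (inj₂ h′) → h′ }) inj₂ (proj₂ (proj₂ plan) n h)

    -- n is the first move of Environment; in the other case the play is exactly the plan, hence
    -- finite.
    Outcome : Exec → Set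
    Outcome w = (Σ ℕ λ n → Σ Event λ σ → at w n ≡ just σ × sysAct (action σ) ≡ false ×
                   (∀ {m} → m < n → at w m ≡ nth E m))
              ⊎ (∀ m → at w m ≡ nth E m)

    outcome : ∀ w → Compatible strategy w → Fair strategy w → Outcome w
    outcome w C fair = scan (length E) 0 refl λ ()
      where
        F : Follows strategy w
        F = compatible⇒follows strategy w C
        -- A fair play cannot end while the plan still prescribes an event.
        ends : ∀ w → Fair strategy w → ∀ {n} → at w n ≡ nothing → length E ≤ n
        ends (inj₁ l) fair h = ≤-trans (nth-nothing⁻¹ E (trans (sym (strategy-out l)) fair)) (nth-nothing⁻¹ l h)
        beyond : ∀ w {n m} → at w n ≡ nothing → n ≤ m → at w m ≡ nothing
        beyond (inj₁ l) h n≤m = nth-nothing l (≤-trans (nth-nothing⁻¹ l h) n≤m)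
        -- d measures the unplayed part of the plan. At d = 0 the strategy is silent, so no further
        -- System event is compatible.
        scan : ∀ d n → n + d ≡ length E → (∀ {m} → m < n → at w m ≡ nth E m) → Outcome w
        scan d n n+d same with at w n in hn
        ... | nothing = inj₂ all
          where
            all : ∀ m → at w m ≡ nth E m
            all m with m <? n
            ... | yes m<n = same m<n
            ... | no  m≮n = trans (beyond w hn (≮⇒≥ m≮n)) (sym (nth-nothing E (≤-trans (ends w fair hn) (≮⇒≥ m≮n))))
        ... | just σ with sysAct (action σ) in sysσ
        ...   | false = inj₁ (n , σ , hn , sysσ , same)
        ...   | true with trans (sym (strategy-out (pre w n))) (F n hn sysσ)
        ...     | played with trans (cong (nth E) (sym (length-pre w hn))) played
        scan zero n n+d same | just σ | true | _ | h =
          ⊥-elim (<-irrefl (trans (sym (+-identityʳ n)) n+d) (nth-< E h))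
        scan (suc d) n n+d same | just σ | true | _ | h =
          scan d (suc n) (trans (sym (+-suc n d)) n+d) same′
          where
            same′ : ∀ {m} → m < suc n → at w m ≡ nth E m
            same′ {m} m< with m ≟ n
            ... | yes refl = trans hn (sym h)
            ... | no  m≢n  = same (≤∧≢⇒< (≤-pred m<) m≢n)

    module _ {w : Exec} (ρ : Env w) where

      transport : ∀ {n} → (∀ {m} → m < n → at w m ≡ nth E m) →
                  ∀ {τ} → Before (inj₁ E) n τ → Before w n τ
      transport same (m , m<n , h) = m , m<n , trans (same m<n) h

      transport⁻¹ : ∀ {n} → (∀ {m} → m < n → at w m ≡ nth E m) →
                    ∀ {τ} → Before w n τ → Before (inj₁ E) n τ
      transport⁻¹ same (m , m<n , h) = m , m<n , trans (sym (same m<n)) h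

      -- Being caught requires a holder right after a test, but `legal-test` exhibits a decrement
      -- for every increment before it.
      queried : ∀ {n σ} → at w n ≡ just σ → sysAct (action σ) ≡ false →
                (∀ {m} → m < n → at w m ≡ nth E m) → ⟦ failedQuery ⟧ ρ
      queried {n} hσ env same with position w hσ
      ... | i , refl , refl = failedQuery-intro ρ i (environment-action env) first
            λ h → caught-elim ρ h refute
        where
          first : ∀ τ → Before w n τ → tg τ ≢ query
          first τ (m , m<n , h) = system-action (system (trans (sym (same m<n)) h))
          refute : ∀ i′ n′ {σ τ} → inj₂ i ≡ inj₂ i′ → pos w i′ ≡ suc n′ → at w n′ ≡ just σ → tg σ ≡ test →
                   Before w (suc n′) τ → Does up (ct σ) (proc (letter w i′)) τ →
                   Σ Event λ τ′ → Before w (suc n′) τ′ × Does down (ct σ) (proc (letter w i′)) τ′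
          refute _ n′ {σ} refl i≡ hσ tσ bτ d with only (before-extends w hσ) bτ
          ... | inj₂ refl with trans (sym tσ) (proj₁ d)
          ...   | ()
          refute _ n′ {σ} refl i≡ hσ tσ bτ d | inj₁ bτ′ =
            let same′ : ∀ {m} → m < suc n′ → at w m ≡ nth E m
                same′ m< = same (subst (_ <_) (sym i≡) m<)
                τ′ , b′ , d′ = legal-test (legal (trans (sym (same′ (n<1+n n′))) hσ)) tσ
                                 (transport⁻¹ (λ m< → same′ (m<n⇒m<1+n m<)) bτ′) d
            in τ′ , old (before-extends w hσ) (transport (λ m< → same′ (m<n⇒m<1+n m<)) b′) , d′

      completed : (∀ m → at w m ≡ nth E m) → ⟦ neg (or violation (neg (startsWith as b))) ⟧ ρ
      completed same (inj₂ h) = h (startsWith-intro as b ρ λ n ha →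
        let σ , hσ , a≡ = event-at (prefix≡ n ha) in σ , trans (same n) hσ , a≡)
      completed same (inj₁ (inj₁ h)) = link-elim ρ h λ n hσ hτ →
        run-linked run n (action-of (trans (sym (same n)) hσ)) (action-of (trans (sym (same (suc n))) hτ)) ,
        trans (sym (sysAct-spec _)) (system (trans (sym (same (suc n))) hτ))
      completed same (inj₁ (inj₂ (inj₁ h))) = repeated-elim ρ h λ n hσ tσ bτ d →
        legal-up (legal (trans (sym (same n)) hσ)) tσ (transport⁻¹ (λ _ → same _) bτ) d
      completed same (inj₁ (inj₂ (inj₂ (inj₁ h)))) = repeated-elim ρ h λ n hσ tσ bτ d →
        proj₂ (legal-down (legal (trans (sym (same n)) hσ)) tσ) (transport⁻¹ (λ _ → same _) bτ) d
      completed same (inj₁ (inj₂ (inj₂ (inj₂ (inj₁ h))))) = unmatched-elim ρ h λ n hσ tσ →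
        let τ , bτ , d = proj₁ (legal-down (legal (trans (sym (same n)) hσ)) tσ)
        in τ , transport (λ _ → same _) bτ , d
      completed same (inj₁ (inj₂ (inj₂ (inj₂ (inj₂ h))))) =
        let n , a , ha , t = run-stops run
            σ , hσ , a≡ = event-at ha
        in unfinished-elim ρ (trans (same n) hσ) (trans (cong tagOf a≡) t) h

    winning : InWin (spec as b)
    winning = strategy , λ w C fair → inj₁ someone , inj₁ someone , wins w (outcome w C fair)
      where
        -- A witness for the two vacuous outer quantifiers; a run is nonempty, so k is positive.
        someone : Proc
        someone = se , fromℕ< (≤-trans (s≤s z≤n) (≤-trans (nth-< bs (proj₁ (proj₂ (proj₂ (run-stops run))))) bs≤k))
        wins : ∀ w → Outcome w → ⟦_⟧ {w} (or failedQuery (neg (or violation (neg (startsWith as b)))))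
                                    (update (update (λ _ → nothing) x (inj₁ someone)) y (inj₁ someone))
        wins w (inj₁ (n , σ , hσ , env , same)) = inj₁ (queried _ hσ env same)
        wins w (inj₂ same)                      = inj₂ (completed _ same)

-- Counter programs

data Ins (r : ℕ) : Set where
  incr : Fin r → ℕ → Ins r
  decr : Fin r → ℕ → ℕ → Ins r
  jump : ℕ → Ins r
  halt : Ins r

data _⊢_⟶_ {r} (prog : List (Ins r)) : ℕ × Vec ℕ r → ℕ × Vec ℕ r → Set where
  incr  : ∀ {i v c j} → nth prog i ≡ just (incr c j) → prog ⊢ (i , v) ⟶ (j , v [ c ]≔ suc (lookup v c))
  decr₀ : ∀ {i v c j j′} → nth prog i ≡ just (decr c j j′) → lookup v c ≡ 0 → prog ⊢ (i , v) ⟶ (j , v)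
  decr₁ : ∀ {i v c j j′ m} → nth prog i ≡ just (decr c j j′) → lookup v c ≡ suc m →
          prog ⊢ (i , v) ⟶ (j′ , v [ c ]≔ m)
  jump  : ∀ {i v j} → nth prog i ≡ just (jump j) → prog ⊢ (i , v) ⟶ (j , v)

_⊢_⟶*_ : ∀ {r} → List (Ins r) → ℕ × Vec ℕ r → ℕ × Vec ℕ r → Set
prog ⊢ κ ⟶* κ′ = Star (prog ⊢_⟶_) κ κ′

data Cmd (r : ℕ) : Set where
  nil   : Cmd r
  bump  : Fin r → Cmd r
  _⨾_   : Cmd r → Cmd r → Cmd r
  while : Fin r → Cmd r → Cmd r

infixr 5 _⨾_

-- while c P decrements c before each execution of P, until c is zero.
data _∶_⇒_ {r} : Cmd r → Vec ℕ r → Vec ℕ r → Set where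
  nil  : ∀ {v} → nil ∶ v ⇒ v
  bump : ∀ {c v} → bump c ∶ v ⇒ (v [ c ]≔ suc (lookup v c))
  _⨾_  : ∀ {P Q v v′ v″} → P ∶ v ⇒ v′ → Q ∶ v′ ⇒ v″ → (P ⨾ Q) ∶ v ⇒ v″
  exit : ∀ {c P v} → lookup v c ≡ 0 → while c P ∶ v ⇒ v
  loop : ∀ {c P v v′ v″ m} → lookup v c ≡ suc m → P ∶ (v [ c ]≔ m) ⇒ v′ → while c P ∶ v′ ⇒ v″ →
         while c P ∶ v ⇒ v″

size : ∀ {r} → Cmd r → ℕ
size nil         = 0
size (bump c)    = 1
size (P ⨾ Q)     = size P + size Q
size (while c P) = suc (size P + 1)

-- Jumps are absolute, so the code depends on its start address i.
compile : ∀ {r} → Cmd r → ℕ → List (Ins r)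
compile nil         i = []
compile (bump c)    i = incr c (i + 1) ∷ []
compile (P ⨾ Q)     i = compile P i ++ compile Q (i + size P)
compile (while c P) i = decr c (i + suc (size P + 1)) (suc i) ∷ compile P (suc i) ++ jump i ∷ []

length-compile : ∀ {r} (P : Cmd r) i → length (compile P i) ≡ size P
length-compile nil         i = refl
length-compile (bump c)    i = refl
length-compile (P ⨾ Q)     i =
  trans (LP.length-++ (compile P i)) (cong₂ _+_ (length-compile P i) (length-compile Q (i + size P)))
length-compile (while c P) i =
  cong suc (trans (LP.length-++ (compile P (suc i))) (cong (_+ 1) (length-compile P (suc i))))

nth-++ˡ : ∀ {A : Set} (xs ys : List A) {n a} → nth xs n ≡ just a → nth (xs ++ ys) n ≡ just a
nth-++ˡ (z ∷ xs) ys {zero}  h = h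
nth-++ˡ (z ∷ xs) ys {suc n} h = nth-++ˡ xs ys h

nth-++ʳ : ∀ {A : Set} (xs ys : List A) n → nth (xs ++ ys) (length xs + n) ≡ nth ys n
nth-++ʳ []       ys n = refl
nth-++ʳ (z ∷ xs) ys n = nth-++ʳ xs ys n

record CodeAt {r} (prog : List (Ins r)) (i : ℕ) (code : List (Ins r)) : Set where
  constructor codeAt
  field fetch : ∀ n {ins} → nth code n ≡ just ins → nth prog (i + n) ≡ just ins

open CodeAt

codeAt-++ˡ : ∀ {r} {prog : List (Ins r)} {i} xs ys → CodeAt prog i (xs ++ ys) → CodeAt prog i xs
codeAt-++ˡ xs ys H = codeAt λ n h → fetch H n (nth-++ˡ xs ys h)

codeAt-++ʳ : ∀ {r} {prog : List (Ins r)} {i} xs ys → CodeAt prog i (xs ++ ys) →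
             CodeAt prog (i + length xs) ys
codeAt-++ʳ {prog = prog} {i} xs ys H = codeAt λ n h →
  trans (cong (nth prog) (+-assoc i (length xs) n)) (fetch H (length xs + n) (trans (nth-++ʳ xs ys n) h))

codeAt-head : ∀ {r} {prog : List (Ins r)} {i ins code} → CodeAt prog i (ins ∷ code) → nth prog i ≡ just ins
codeAt-head {prog = prog} {i} H = trans (cong (nth prog) (sym (+-identityʳ i))) (fetch H 0 refl)

codeAt-tail : ∀ {r} {prog : List (Ins r)} {i ins code} → CodeAt prog i (ins ∷ code) → CodeAt prog (suc i) code
codeAt-tail {prog = prog} {i} H = codeAt λ n h →
  trans (cong (nth prog) (sym (+-suc i n))) (fetch H (suc n) h)

-- By induction on the derivation, not on the command: a further round of a loop reuses the same
-- code at the same address.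
compile-correct : ∀ {r} {prog : List (Ins r)} {P v v′} → P ∶ v ⇒ v′ → ∀ i → CodeAt prog i (compile P i) →
                  prog ⊢ (i , v) ⟶* (i + size P , v′)
compile-correct {prog = prog} {v = v} nil i H =
  subst (λ j → prog ⊢ (i , v) ⟶* (j , v)) (sym (+-identityʳ i)) done
compile-correct bump i H = incr (codeAt-head H) ◅ done
compile-correct {prog = prog} {P ⨾ Q} {v} {v″} (_⨾_ {v′ = v′} p q) i H =
  compile-correct p i (codeAt-++ˡ (compile P i) _ H) ◅◅
  subst (λ j → prog ⊢ (i + size P , v′) ⟶* (j , v″)) (+-assoc i (size P) (size Q))
    (compile-correct q (i + size P)
      (subst (λ m → CodeAt prog (i + m) (compile Q (i + size P))) (length-compile P i)
        (codeAt-++ʳ (compile P i) _ H)))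
compile-correct (exit h) i H = decr₀ (codeAt-head H) h ◅ done
compile-correct {prog = prog} {while c P} (loop h p q) i H =
  decr₁ (codeAt-head H) h ◅
  (compile-correct p (suc i) (codeAt-++ˡ (compile P (suc i)) _ (codeAt-tail H)) ◅◅
   (jump (codeAt-head (subst (λ m → CodeAt prog (suc i + m) (jump i ∷ [])) (length-compile P (suc i))
                        (codeAt-++ʳ (compile P (suc i)) _ (codeAt-tail H)))) ◅
    compile-correct q i H))

-- Programs as rule systems.  State 0 loads the first two counters, and the
-- instruction at address i is executed in state suc i.

module Rules {r : ℕ} (prog : List (Ins (suc (suc r)))) where

  private
    c₀ c₁ : Fin (suc (suc r))
    c₀ = zero
    c₁ = suc zero

  rulesOf : ℕ → Ins (suc (suc r)) → List (Rule (suc (suc r)))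
  rulesOf i (incr c j)    = mkRule (suc i) up c (suc j) ∷ []
  rulesOf i (decr c j j′) = mkRule (suc i) test c (suc j) ∷ mkRule (suc i) down c (suc j′) ∷ []
  rulesOf i (jump j)      = mkRule (suc i) skip c₀ (suc j) ∷ []
  rulesOf i halt          = mkRule (suc i) stop c₀ 0 ∷ []

  progRules : ℕ → List (Ins (suc (suc r))) → List (Rule (suc (suc r)))
  progRules i []          = []
  progRules i (ins ∷ inss) = rulesOf i ins ++ progRules (suc i) inss

  queries : List (Rule (suc (suc r)))
  queries = L.map (λ c → mkRule 0 query c 0) (L.allFin _)

  rules : List (Rule (suc (suc r)))
  rules = mkRule 0 up c₀ 0 ∷ mkRule 0 up c₁ 0 ∷ mkRule 0 skip c₀ 1 ∷ queries ++ progRules 0 prog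

  rule : Fin (length rules) → Rule (suc (suc r))
  rule = L.lookup rules

  load₀ load₁ start : Fin (length rules)
  load₀ = zero
  load₁ = suc zero
  start = suc (suc zero)

  ∈-progRules⁺ : ∀ i inss {n ins ρ} → nth inss n ≡ just ins → ρ ∈ rulesOf (i + n) ins → ρ ∈ progRules i inss
  ∈-progRules⁺ i (ins ∷ inss) {zero} {ρ = ρ} refl ρ∈ =
    ∈-++⁺ˡ (subst (λ j → ρ ∈ rulesOf j ins) (+-identityʳ i) ρ∈)
  ∈-progRules⁺ i (ins ∷ inss) {suc n} {ins′} {ρ} h ρ∈ =
    ∈-++⁺ʳ (rulesOf i ins) (∈-progRules⁺ (suc i) inss h (subst (λ j → ρ ∈ rulesOf j ins′) (+-suc i n) ρ∈))

  ∈-progRules⁻ : ∀ i inss {ρ} → ρ ∈ progRules i inss →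
                 Σ ℕ λ n → Σ (Ins _) λ ins → nth inss n ≡ just ins × ρ ∈ rulesOf (i + n) ins
  ∈-progRules⁻ i (ins ∷ inss) {ρ} ρ∈ with ∈-++⁻ (rulesOf i ins) ρ∈
  ... | inj₁ h = 0 , ins , refl , subst (λ j → ρ ∈ rulesOf j ins) (sym (+-identityʳ i)) h
  ... | inj₂ h with ∈-progRules⁻ (suc i) inss h
  ...   | n , ins′ , h′ , ρ∈′ = suc n , ins′ , h′ , subst (λ j → ρ ∈ rulesOf j ins′) (sym (+-suc i n)) ρ∈′

  src-rulesOf : ∀ i ins {ρ} → ρ ∈ rulesOf i ins → src ρ ≡ suc i
  src-rulesOf i (incr c j)    (here refl)         = refl
  src-rulesOf i (decr c j j′) (here refl)         = refl
  src-rulesOf i (decr c j j′) (there (here refl)) = refl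
  src-rulesOf i (jump j)      (here refl)         = refl
  src-rulesOf i halt          (here refl)         = refl

  letter-of : ∀ {ρ} → ρ ∈ rules → Σ (Fin (length rules)) λ a → rule a ≡ ρ
  letter-of ρ∈ = Any.index ρ∈ , sym (lookup-index ρ∈)

  letter-of-ins : ∀ {i ins ρ} → nth prog i ≡ just ins → ρ ∈ rulesOf i ins →
                  Σ (Fin (length rules)) λ a → rule a ≡ ρ
  letter-of-ins h ρ∈ = letter-of (there (there (there (∈-++⁺ʳ queries (∈-progRules⁺ 0 prog h ρ∈)))))

  query-on : ∀ c → Σ (Fin (length rules)) λ a → tag (rule a) ≡ query × ctr (rule a) ≡ c
  query-on c with letter-of (there (there (there (∈-++⁺ˡ (∈-map⁺ (λ c → mkRule 0 query c 0) (∈-allFin c))))))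
  ... | a , a≡ = a , cong tag a≡ , cong ctr a≡

  -- Loading and query rules start in state 0, so a state `suc i` offers only the rules of
  -- instruction i.
  ins-of-letter : ∀ {i} a → src (rule a) ≡ suc i → Σ (Ins _) λ ins → nth prog i ≡ just ins × rule a ∈ rulesOf i ins
  ins-of-letter a h = go (∈-lookup {xs = rules} a) h
    where
      go : ∀ {i ρ} → ρ ∈ rules → src ρ ≡ suc i → Σ (Ins _) λ ins → nth prog i ≡ just ins × ρ ∈ rulesOf i ins
      go (here refl) ()
      go (there (here refl)) ()
      go (there (there (here refl))) ()
      go {i} (there (there (there ρ∈))) h with ∈-++⁻ queries ρ∈
      ... | inj₁ q∈ with ∈-map⁻ (λ c → mkRule 0 query c 0) q∈
      ...   | _ , _ , refl with h
      ...     | ()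
      go {i} (there (there (there ρ∈))) h | inj₂ p∈ with ∈-progRules⁻ 0 prog p∈
      ... | n , ins , h′ , ρ∈′ with trans (sym (src-rulesOf n ins ρ∈′)) h
      ...   | refl = ins , h′ , ρ∈′

  Next : Rule (suc (suc r)) → Vec ℕ (suc (suc r)) → Set
  Next ρ v = tag ρ ≡ stop ⊎
    (Σ _ λ v′ → Σ _ λ bs → Effect (tag ρ) (ctr ρ) v v′ × Run rule (tgt ρ) v′ bs)

  Accepts : ℕ → Vec ℕ (suc (suc r)) → Set
  Accepts q v = Σ _ λ bs → Run rule q v bs

  accepts-next : ∀ {q v bs} → Run rule q v bs → Σ _ λ a → src (rule a) ≡ q × Next (rule a) v
  accepts-next (stop {a = a} h t)   = a , h , inj₁ t
  accepts-next (move {a = a} h ε ρ) = a , h , inj₂ (_ , _ , ε , ρ)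

  next-accepts : ∀ {i ins ρ v v′} → nth prog i ≡ just ins → ρ ∈ rulesOf i ins →
                 Effect (tag ρ) (ctr ρ) v v′ → Accepts (tgt ρ) v′ → Accepts (suc i) v
  next-accepts {i} {ins} h ρ∈ ε (bs , run) with letter-of-ins h ρ∈
  ... | a , refl = a ∷ bs , move (src-rulesOf i ins ρ∈) ε run

  next-ins : ∀ {i ins v} → nth prog i ≡ just ins → Accepts (suc i) v →
             Σ _ λ ρ → ρ ∈ rulesOf i ins × Next ρ v
  next-ins h (_ , run) with accepts-next run
  ... | a , src≡ , next with ins-of-letter a src≡
  ...   | ins , h′ , ρ∈ with trans (sym h) h′
  ...     | refl = rule a , ρ∈ , next

  backward : ∀ {i v j v′} → prog ⊢ (i , v) ⟶ (j , v′) → Accepts (suc j) v′ → Accepts (suc i) v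
  backward (incr h)    = next-accepts h (here refl) up
  backward (decr₀ h z) = next-accepts h (here refl) (test z)
  backward (decr₁ h z) = next-accepts h (there (here refl)) (down z)
  backward (jump h)    = next-accepts h (here refl) skip

  -- Acceptance survives because the step is forced: test and decrement of one instruction exclude
  -- each other by the counter value.
  forward : ∀ {i v j v′} → prog ⊢ (i , v) ⟶ (j , v′) → Accepts (suc i) v → Accepts (suc j) v′
  forward (incr h) acc with next-ins h acc
  ... | _ , here refl , inj₂ (_ , _ , up , run) = _ , run
  forward (decr₀ h z) acc with next-ins h acc
  ... | _ , here refl , inj₂ (_ , _ , test _ , run) = _ , run
  ... | _ , there (here refl) , inj₂ (_ , _ , down z′ , run) with trans (sym z) z′
  ...   | ()
  forward (decr₁ h z) acc with next-ins h acc
  ... | _ , here refl , inj₂ (_ , _ , test z′ , run) with trans (sym z) z′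
  ...   | ()
  forward (decr₁ h z) acc | _ , there (here refl) , inj₂ (_ , _ , down z′ , run) with trans (sym z) z′
  ... | refl = _ , run
  forward (jump h) acc with next-ins h acc
  ... | _ , here refl , inj₂ (_ , _ , skip , run) = _ , run

  backward* : ∀ {i v j v′} → prog ⊢ (i , v) ⟶* (j , v′) → Accepts (suc j) v′ → Accepts (suc i) v
  backward* done       acc = acc
  backward* (st ◅ sts) acc = backward st (backward* sts acc)

  forward* : ∀ {i v j v′} → prog ⊢ (i , v) ⟶* (j , v′) → Accepts (suc i) v → Accepts (suc j) v′
  forward* done       acc = acc
  forward* (st ◅ sts) acc = forward* sts (forward st acc)

  halted : ∀ {i v} → nth prog i ≡ just halt → Accepts (suc i) v
  halted h with letter-of-ins h (here refl)
  ... | a , a≡ = a ∷ [] , stop (cong src a≡) (cong tag a≡)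

  stuck : ∀ {i v} → nth prog i ≡ nothing → ¬ Accepts (suc i) v
  stuck h (_ , run) with accepts-next run
  ... | a , src≡ , _ with ins-of-letter a src≡
  ...   | _ , h′ , _ with trans (sym h) h′
  ...     | ()

  loads : ℕ → ℕ → List (Fin (length rules))
  loads α β = L.replicate α load₀ ++ L.replicate β load₁

  load : ∀ α β {a b v bs} → Run rule 1 (α + a ∷ β + b ∷ v) bs →
         Run rule 0 (a ∷ b ∷ v) (loads α β ++ start ∷ bs)
  load zero zero run = move refl skip run
  load zero (suc β) {a} {b} {v} {bs} run =
    move refl up (load 0 β (subst (λ n → Run rule 1 (a ∷ n ∷ v) bs) (sym (+-suc β b)) run))
  load (suc α) β {a} {b} {v} {bs} run =
    move refl up (load α β (subst (λ n → Run rule 1 (n ∷ β + b ∷ v) bs) (sym (+-suc α a)) run))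

  -- Agreement fixes the letters one by one, and no prescribed letter is a stop, so the run cannot
  -- end before `start` has been played.
  loaded : ∀ α β {q a b v bs} → Run rule q (a ∷ b ∷ v) bs → Agree bs (loads α β ∷ʳ start) →
           Accepts 1 (α + a ∷ β + b ∷ v)
  loaded zero zero (stop _ t) ag with ag 0 refl refl
  loaded zero zero (stop _ ()) ag | refl
  loaded zero zero (move _ ε run) ag with ag 0 refl refl
  loaded zero zero (move _ skip run) ag | refl = _ , run
  loaded zero (suc β) (stop _ t) ag with ag 0 refl refl
  loaded zero (suc β) (stop _ ()) ag | refl
  loaded zero (suc β) (move _ ε run) ag with ag 0 refl refl
  loaded zero (suc β) {a = a} {b} {v} (move _ up run) ag | refl =
    subst (λ n → Accepts 1 (a ∷ n ∷ v)) (+-suc β b) (loaded 0 β run λ n → ag (suc n))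
  loaded (suc α) β (stop _ t) ag with ag 0 refl refl
  loaded (suc α) β (stop _ ()) ag | refl
  loaded (suc α) β (move _ ε run) ag with ag 0 refl refl
  loaded (suc α) β {a = a} {b} {v} (move _ up run) ag | refl =
    subst (λ n → Accepts 1 (n ∷ β + b ∷ v)) (+-suc α a) (loaded α β run λ n → ag (suc n))

-- Codes of formulas

-- Unique splitting into a power of two and an odd number, by parity.
pair-injective : ∀ a b a′ b′ → pair a b ≡ pair a′ b′ → a ≡ a′ × b ≡ b′
pair-injective zero b zero b′ h =
  refl , *-cancelˡ-≡ b b′ 2 (suc-injective (trans (sym (*-identityˡ _)) (trans h (*-identityˡ _))))
pair-injective zero b (suc a′) b′ h =
  ⊥-elim (even≢odd (pair a′ b′) b
    (trans (sym (*-assoc 2 (2 ^ a′) (suc (2 * b′)))) (trans (sym h) (*-identityˡ _))))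
pair-injective (suc a) b zero b′ h =
  ⊥-elim (even≢odd (pair a b) b′
    (trans (sym (*-assoc 2 (2 ^ a) (suc (2 * b)))) (trans h (*-identityˡ _))))
pair-injective (suc a) b (suc a′) b′ h =
  let p , q = pair-injective a b a′ b′ (*-cancelˡ-≡ (pair a b) (pair a′ b′) 2
                (trans (sym (*-assoc 2 (2 ^ a) (suc (2 * b)))) (trans h (*-assoc 2 (2 ^ a′) (suc (2 * b′))))))
  in cong suc p , q

encList-tabulate-injective : ∀ {n} (g g′ : Fin n → ℕ) →
                             encList (tabulate g) ≡ encList (tabulate g′) → ∀ i → g i ≡ g′ i
encList-tabulate-injective {suc n} g g′ h =
  λ { zero → proj₁ heads ; (suc i) → encList-tabulate-injective (g ∘ suc) (g′ ∘ suc) (proj₂ heads) i }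
  where
    heads : g zero ≡ g′ zero × encList (tabulate (g ∘ suc)) ≡ encList (tabulate (g′ ∘ suc))
    heads = pair-injective (g zero) (encList (tabulate (g ∘ suc))) (g′ zero) (encList (tabulate (g′ ∘ suc))) h

-- With the constructor number split off, `codes-injective` needs no clauses for different
-- constructors.
headCode : ∀ {n} → Form n → ℕ
headCode (ty _ _)   = 0
headCode (act _ _)  = 1
headCode (eq _ _)   = 2
headCode (sim _ _)  = 3
headCode (lt _ _)   = 4
headCode (succ _ _) = 5
headCode (neg _)    = 6
headCode (or _ _)   = 7
headCode (ex _ _)   = 8

bodyCode : ∀ {n} → Form n → ℕ
bodyCode (ty t v)   = pair (tyCode t) (toℕ v)
bodyCode (act a v)  = pair (toℕ a) (toℕ v)
bodyCode (eq u v)   = pair (toℕ u) (toℕ v)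
bodyCode (sim u v)  = pair (toℕ u) (toℕ v)
bodyCode (lt u v)   = pair (toℕ u) (toℕ v)
bodyCode (succ u v) = pair (toℕ u) (toℕ v)
bodyCode (neg φ)    = encForm φ
bodyCode (or φ ψ)   = pair (encForm φ) (encForm ψ)
bodyCode (ex v φ)   = pair (toℕ v) (encForm φ)

encForm-pair : ∀ {n} (φ : Form n) → encForm φ ≡ pair (headCode φ) (bodyCode φ)
encForm-pair (ty _ _)   = refl
encForm-pair (act _ _)  = refl
encForm-pair (eq _ _)   = refl
encForm-pair (sim _ _)  = refl
encForm-pair (lt _ _)   = refl
encForm-pair (succ _ _) = refl
encForm-pair (neg _)    = refl
encForm-pair (or _ _)   = refl
encForm-pair (ex _ _)   = refl

tyCode-injective : ∀ t t′ → tyCode t ≡ tyCode t′ → t ≡ t′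
tyCode-injective s  s  _ = refl
tyCode-injective e  e  _ = refl
tyCode-injective se se _ = refl

variables-injective : ∀ {m n} (u : Fin m) (v : Fin n) u′ v′ → pair (toℕ u) (toℕ v) ≡ pair (toℕ u′) (toℕ v′) →
                      u ≡ u′ × v ≡ v′
variables-injective u v u′ v′ h =
  let p , q = pair-injective (toℕ u) (toℕ v) (toℕ u′) (toℕ v′) h in toℕ-injective p , toℕ-injective q

encForm-injective : ∀ {n} (φ ψ : Form n) → encForm φ ≡ encForm ψ → φ ≡ ψ
codes-injective : ∀ {n} (φ ψ : Form n) → headCode φ ≡ headCode ψ → bodyCode φ ≡ bodyCode ψ → φ ≡ ψ

encForm-injective φ ψ h =
  let p , q = pair-injective (headCode φ) (bodyCode φ) (headCode ψ) (bodyCode ψ)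
                (trans (sym (encForm-pair φ)) (trans h (encForm-pair ψ)))
  in codes-injective φ ψ p q

codes-injective (ty t v) (ty t′ v′) refl h =
  let p , q = pair-injective (tyCode t) (toℕ v) (tyCode t′) (toℕ v′) h
  in cong₂ ty (tyCode-injective t t′ p) (toℕ-injective q)
codes-injective (act a v) (act a′ v′) refl h =
  let p , q = variables-injective a v a′ v′ h in cong₂ act p q
codes-injective (eq u v) (eq u′ v′) refl h =
  let p , q = variables-injective u v u′ v′ h in cong₂ eq p q
codes-injective (sim u v) (sim u′ v′) refl h =
  let p , q = variables-injective u v u′ v′ h in cong₂ sim p q
codes-injective (lt u v) (lt u′ v′) refl h =
  let p , q = variables-injective u v u′ v′ h in cong₂ lt p q
codes-injective (succ u v) (succ u′ v′) refl h =
  let p , q = variables-injective u v u′ v′ h in cong₂ succ p q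
codes-injective (neg φ) (neg φ′) refl h = cong neg (encForm-injective φ φ′ h)
codes-injective (or φ ψ) (or φ′ ψ′) refl h =
  let p , q = pair-injective (encForm φ) (encForm ψ) (encForm φ′) (encForm ψ′) h
  in cong₂ or (encForm-injective φ φ′ p) (encForm-injective ψ ψ′ q)
codes-injective (ex v φ) (ex v′ φ′) refl h =
  let p , q = pair-injective (toℕ v) (encForm φ) (toℕ v′) (encForm φ′) h
  in cong₂ ex (toℕ-injective p) (encForm-injective φ φ′ q)

bit-injective : ∀ b b′ → (if b then 1 else 0) ≡ (if b′ then 1 else 0) → b ≡ b′
bit-injective true  true  _ = refl
bit-injective false false _ = refl

-- A code determines the partition of the alphabet only pointwise; hence `Semantics` asks for a
-- pointwise description of `sysAct`.
data SameInstance {n} (f : Fin n → Bool) (φ : Form n) : ∀ n′ → (Fin n′ → Bool) → Form n′ → Set where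
  same : ∀ {f′} → (∀ a → f′ a ≡ f a) → SameInstance f φ n f′ φ

encInstance-injective : ∀ {n} f (φ : Form n) n′ f′ φ′ → encInstance n′ f′ φ′ ≡ encInstance n f φ →
                        SameInstance f φ n′ f′ φ′
encInstance-injective {n} f φ n′ f′ φ′ h
  with pair-injective n′ (pair (bits f′) (encForm φ′)) n (pair (bits f) (encForm φ)) h
  where
    bits : ∀ {m} → (Fin m → Bool) → ℕ
    bits g = encList (tabulate (λ a → if g a then 1 else 0))
... | refl , h₁ with pair-injective _ (encForm φ′) _ (encForm φ) h₁
...   | h₂ , h₃ with encForm-injective φ′ φ h₃
...     | refl = same λ a → bit-injective (f′ a) (f a)
                   (encList-tabulate-injective (λ a → if f′ a then 1 else 0) (λ a → if f a then 1 else 0) h₂ a)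

-- Codes as affine functions.

record Affine (f : ℕ → ℕ) : Set where
  field
    offset : ℕ
    slope  : ℕ
    law    : ∀ n → f n ≡ offset + slope * n

-- Abstract because these numbers are far too large to be unfolded.
abstract

  code : ℕ → ℕ → ℕ
  code = pair

  code-pair : ∀ a b → code a b ≡ pair a b
  code-pair a b = refl

  affine-code : ∀ a → Affine (code a)
  affine-code a = record
    { offset = 2 ^ a
    ; slope  = 2 ^ a * 2
    ; law    = λ n → trans (*-suc (2 ^ a) (2 * n)) (cong (2 ^ a +_) (sym (*-assoc (2 ^ a) 2 n))) }

  affine-∘ : ∀ {f g} → Affine f → Affine g → Affine (f ∘ g)
  affine-∘ {f} {g} F G = record
    { offset = F′.offset + F′.slope * G′.offset
    ; slope  = F′.slope * G′.slope
    ; law    = λ n → begin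
        f (g n)                                               ≡⟨ F′.law (g n) ⟩
        F′.offset + F′.slope * g n                              ≡⟨ cong (λ m → F′.offset + F′.slope * m) (G′.law n) ⟩
        F′.offset + F′.slope * (G′.offset + G′.slope * n)         ≡⟨ cong (F′.offset +_) (*-distribˡ-+ F′.slope G′.offset _) ⟩
        F′.offset + (F′.slope * G′.offset + F′.slope * (G′.slope * n))
          ≡⟨ sym (+-assoc F′.offset _ _) ⟩
        F′.offset + F′.slope * G′.offset + F′.slope * (G′.slope * n)
          ≡⟨ cong (F′.offset + F′.slope * G′.offset +_) (sym (*-assoc F′.slope G′.slope n)) ⟩
        F′.offset + F′.slope * G′.offset + F′.slope * G′.slope * n ∎ }
    where
      open ≡-Reasoning
      module F′ = Affine F
      module G′ = Affine G

-- `encForm` over the abstract `code`, so that type checking never evaluates the powers of two.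
formCode : ∀ {n} → Form n → ℕ
formCode (ty t v)   = code 0 (code (tyCode t) (toℕ v))
formCode (act a v)  = code 1 (code (toℕ a) (toℕ v))
formCode (eq u v)   = code 2 (code (toℕ u) (toℕ v))
formCode (sim u v)  = code 3 (code (toℕ u) (toℕ v))
formCode (lt u v)   = code 4 (code (toℕ u) (toℕ v))
formCode (succ u v) = code 5 (code (toℕ u) (toℕ v))
formCode (neg φ)    = code 6 (formCode φ)
formCode (or φ ψ)   = code 7 (code (formCode φ) (formCode ψ))
formCode (ex v φ)   = code 8 (code (toℕ v) (formCode φ))

code-cong : ∀ a b {a′ b′} → a ≡ a′ → b ≡ b′ → code a b ≡ pair a′ b′
code-cong a b refl refl = code-pair a b

formCode-encForm : ∀ {n} (φ : Form n) → formCode φ ≡ encForm φ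
formCode-encForm (ty t v)   = code-cong 0 _ refl (code-pair _ _)
formCode-encForm (act a v)  = code-cong 1 _ refl (code-pair _ _)
formCode-encForm (eq u v)   = code-cong 2 _ refl (code-pair _ _)
formCode-encForm (sim u v)  = code-cong 3 _ refl (code-pair _ _)
formCode-encForm (lt u v)   = code-cong 4 _ refl (code-pair _ _)
formCode-encForm (succ u v) = code-cong 5 _ refl (code-pair _ _)
formCode-encForm (neg φ)    = code-cong 6 _ refl (formCode-encForm φ)
formCode-encForm (or φ ψ)   = code-cong 7 _ refl (code-cong _ _ (formCode-encForm φ) (formCode-encForm ψ))
formCode-encForm (ex v φ)   = code-cong 8 _ refl (code-cong _ _ refl (formCode-encForm φ))

instanceCode : (n : ℕ) → (Fin n → Bool) → Form n → ℕ
instanceCode n f φ = code n (code (encList (tabulate (λ a → if f a then 1 else 0))) (formCode φ))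

instanceCode-encInstance : ∀ n f φ → instanceCode n f φ ≡ encInstance n f φ
instanceCode-encInstance n f φ = code-cong n _ refl (code-cong _ _ refl (formCode-encForm φ))

-- The diagonal program

-- Updates an accumulator as a program loop does, whereas `reads` adds layers on the outside;
-- `iterate′-suc` reconciles the two.
iterate′ : (ℕ → ℕ) → ℕ → ℕ → ℕ
iterate′ f zero    t = t
iterate′ f (suc n) t = iterate′ f n (f t)

iterate′-suc : ∀ f n t → iterate′ f n (f t) ≡ f (iterate′ f n t)
iterate′-suc f zero    t = refl
iterate′-suc f (suc n) t = iterate′-suc f n (f t)

add : ∀ {r} → Fin r → ℕ → Cmd r
add c zero    = nil
add c (suc n) = bump c ⨾ add c n

add-correct : ∀ {r} (c : Fin r) n v → add c n ∶ v ⇒ (v [ c ]≔ (n + lookup v c))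
add-correct c zero    v = subst (nil ∶ v ⇒_) (sym (VP.[]≔-lookup v c)) nil
add-correct c (suc n) v = bump ⨾ subst (add c n ∶ _ ⇒_) final (add-correct c n _)
  where
    w = v [ c ]≔ suc (lookup v c)
    final : w [ c ]≔ (n + lookup w c) ≡ v [ c ]≔ (suc n + lookup v c)
    final = trans (VP.[]≔-idempotent v c)
              (cong (v [ c ]≔_) (trans (cong (n +_) (VP.lookup∘update c v _)) (+-suc n _)))

_▸_ : ∀ {r} {P : Cmd r} {v v′ v″} → P ∶ v ⇒ v′ → v′ ≡ v″ → P ∶ v ⇒ v″
p ▸ refl = p

infix 4 _▸_

-- With A = α and B = β, the program puts α + β E into N, where E is the
-- α-fold application of f₁ to the β-fold application of f₂ to t₀.
module Prelude {f₁ f₂ : ℕ → ℕ} (F₁ : Affine f₁) (F₂ : Affine f₂) (t₀ r : ℕ) where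

  A B B′ T U N : Fin (6 + r)
  A  = zero
  B  = suc zero
  B′ = suc (suc zero)
  T  = suc (suc (suc zero))
  U  = suc (suc (suc (suc zero)))
  N  = suc (suc (suc (suc (suc zero))))

  apply : ∀ {f} → Affine f → Cmd (6 + r)
  apply F = while T (add U (Affine.slope F)) ⨾ add U (Affine.offset F) ⨾ while U (bump T)

  prelude : Cmd (6 + r)
  prelude = add T t₀
          -- The β letters B are innermost, so f₂ comes first. β survives in `B′` for the final
          -- product.
          ⨾ while B (bump B′ ⨾ apply F₂)
          -- Counting A down also moves the summand α into N.
          ⨾ while A (bump N ⨾ apply F₁)
          ⨾ while B′ (while T (bump N ⨾ bump U) ⨾ while U (bump T))

  module _ {v : Vec ℕ r} where

    regs : ℕ → ℕ → ℕ → ℕ → ℕ → ℕ → Vec ℕ (6 + r)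
    regs a b b′ t u n = a ∷ b ∷ b′ ∷ t ∷ u ∷ n ∷ v

    transfer : ∀ {a b b′ t n} u → while U (bump T) ∶ regs a b b′ t u n ⇒ regs a b b′ (u + t) 0 n
    transfer zero = exit refl
    transfer {a} {b} {b′} {t} {n} (suc u) =
      loop refl bump (transfer u ▸ cong (λ m → regs a b b′ m 0 n) (+-suc u t))

    scale : ∀ {a b b′ u n} d t → while T (add U d) ∶ regs a b b′ t u n ⇒ regs a b b′ 0 (t * d + u) n
    scale d zero = exit refl
    scale {a} {b} {b′} {u} {n} d (suc t) =
      loop refl (add-correct U d _)
        (scale d t ▸ cong (λ m → regs a b b′ 0 m n)
                       (trans (sym (+-assoc (t * d) d u)) (cong (_+ u) (+-comm (t * d) d))))

    apply-correct : ∀ {f} (F : Affine f) {a b b′ n} t → apply F ∶ regs a b b′ t 0 n ⇒ regs a b b′ (f t) 0 n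
    apply-correct {f} F {a} {b} {b′} {n} t =
      scale slope t ⨾ add-correct U offset _ ⨾
      (transfer _ ▸ cong (λ m → regs a b b′ m 0 n) final)
      where
        open Affine F
        final : offset + (t * slope + 0) + 0 ≡ f t
        final = trans (+-identityʳ _)
                  (trans (cong (offset +_) (trans (+-identityʳ _) (*-comm t slope))) (sym (law t)))

    loop-B : ∀ {a b′ t n} b → while B (bump B′ ⨾ apply F₂) ∶ regs a b b′ t 0 n ⇒
                              regs a 0 (b + b′) (iterate′ f₂ b t) 0 n
    loop-B zero = exit refl
    loop-B {a} {b′} {t} {n} (suc b) =
      loop refl (bump ⨾ apply-correct F₂ t)
        (loop-B b ▸ cong (λ m → regs a 0 m (iterate′ f₂ b (f₂ t)) 0 n) (+-suc b b′))

    loop-A : ∀ {b b′ t n} a → while A (bump N ⨾ apply F₁) ∶ regs a b b′ t 0 n ⇒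
                              regs 0 b b′ (iterate′ f₁ a t) 0 (a + n)
    loop-A zero = exit refl
    loop-A {b} {b′} {t} {n} (suc a) =
      loop refl (bump ⨾ apply-correct F₁ t)
        (loop-A a ▸ cong (regs 0 b b′ (iterate′ f₁ a (f₁ t)) 0) (+-suc a n))

    accumulate : ∀ {a b b′ u n} t → while T (bump N ⨾ bump U) ∶ regs a b b′ t u n ⇒
                                    regs a b b′ 0 (t + u) (t + n)
    accumulate zero = exit refl
    accumulate {a} {b} {b′} {u} {n} (suc t) =
      loop refl (bump ⨾ bump)
        (accumulate t ▸ cong₂ (regs a b b′ 0) (+-suc t u) (+-suc t n))

    loop-B′ : ∀ {a b t n} b′ → while B′ (while T (bump N ⨾ bump U) ⨾ while U (bump T)) ∶ regs a b b′ t 0 n ⇒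
                               regs a b 0 t 0 (b′ * t + n)
    loop-B′ zero = exit refl
    loop-B′ {a} {b} {t} {n} (suc b′) =
      loop refl (accumulate t ⨾ (transfer (t + 0) ▸ cong (λ m → regs a b b′ m 0 (t + n))
                                                      (trans (+-identityʳ _) (+-identityʳ t))))
        (loop-B′ b′ ▸ cong (regs a b 0 t 0)
                        (trans (sym (+-assoc (b′ * t) t n)) (cong (_+ n) (+-comm (b′ * t) t))))

    prelude-correct : ∀ a b → let E = iterate′ f₁ a (iterate′ f₂ b t₀) in
                      prelude ∶ regs a b 0 0 0 0 ⇒ regs 0 0 0 E 0 (a + b * E)
    prelude-correct a b =
      (add-correct T t₀ _ ▸ cong (λ m → regs a b 0 m 0 0) (+-identityʳ t₀)) ⨾ loop-B b ⨾ loop-A a ⨾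
      (loop-B′ (b + 0) ▸ cong (regs 0 0 0 E 0)
        (trans (cong₂ (λ m m′ → m * E + m′) (+-identityʳ b) (+-identityʳ a)) (+-comm (b * E) a)))
      where
        E = iterate′ f₁ a (iterate′ f₂ b t₀)

[]%=-as-[]≔ : ∀ {A : Set} {n} (v : Vec A n) c f → v [ c ]%= f ≡ v [ c ]≔ f (lookup v c)
[]%=-as-[]≔ (z ∷ v) zero    f = refl
[]%=-as-[]≔ (z ∷ v) (suc c) f = cong (z ∷_) ([]%=-as-[]≔ v c f)

-- Runs M on the number computed by the prelude; accepts iff the output of M is 0.
module Diagonal (M : Machine) {f₁ f₂ : ℕ → ℕ} (F₁ : Affine f₁) (F₂ : Affine f₂) (t₀ : ℕ) where

  open Machine M renaming (prog to progM)
  open Prelude F₁ F₂ t₀ nregs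

  len off : ℕ
  len = length progM
  off = size prelude

  -- M halts by leaving its program, so every outside address is sent to the epilogue.
  addr : ℕ → ℕ
  addr j = off + j ⊓ len

  -- The shift by five identifies register 0 of M with N, where the prelude leaves the input.
  embed : Instr (suc nregs) → Ins (6 + nregs)
  embed (inc c j)      = incr (suc (suc (suc (suc (suc c))))) (addr j)
  embed (decjz c j j′) = decr (suc (suc (suc (suc (suc c))))) (addr j) (addr j′)

  -- A nonzero output jumps just behind the text, where no rule applies.
  epilogue : List (Ins (6 + nregs))
  epilogue = decr N (suc (off + len)) (suc (suc (off + len))) ∷ halt ∷ []

  text : List (Ins (6 + nregs))
  text = compile prelude 0 ++ L.map embed progM ++ epilogue

  open Rules text public

  text-rest : CodeAt text off (L.map embed progM ++ epilogue)
  text-rest = subst (λ m → CodeAt text m (L.map embed progM ++ epilogue)) (length-compile prelude 0)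
                (codeAt-++ʳ (compile prelude 0) _ (codeAt λ _ h → h))

  text-M : ∀ {pc ins} → nth progM pc ≡ just ins → nth text (addr pc) ≡ just (embed ins)
  text-M {pc} h =
    trans (cong (λ m → nth text (off + m)) (m≤n⇒m⊓n≡m (<⇒≤ (nth-< progM h))))
      (fetch (codeAt-++ˡ (L.map embed progM) epilogue text-rest) pc
        (trans (nth-map embed progM pc) (cong (M.map embed) h)))

  text-end : CodeAt text (off + len) epilogue
  text-end = subst (λ m → CodeAt text (off + m) epilogue) (LP.length-map embed progM)
               (codeAt-++ʳ (L.map embed progM) epilogue text-rest)

  module _ {t : ℕ} where

    config : Config nregs → ℕ × Vec ℕ (6 + nregs)
    config (pc , v) = addr pc , 0 ∷ 0 ∷ 0 ∷ t ∷ 0 ∷ v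

    simulate-ins : ∀ {pc ins} v → nth progM pc ≡ just ins → text ⊢ config (pc , v) ⟶ config (stepI ins v)
    simulate-ins {pc} {inc c j} v h =
      subst (λ v′ → text ⊢ config (pc , v) ⟶ config (j , v′)) (sym ([]%=-as-[]≔ v c suc)) (incr (text-M h))
    simulate-ins {pc} {decjz c j j′} v h with lookup v c in hc
    ... | zero  = decr₀ (text-M h) hc
    ... | suc m = decr₁ (text-M h) hc

    simulate : ∀ n c → text ⊢ config c ⟶* config (run M n c)
    simulate zero    c = done
    simulate (suc n) (pc , v) with nth progM pc in h
    ... | nothing  = done
    ... | just ins = simulate-ins v h ◅ simulate n (stepI ins v)

    simulate-halted : ∀ {c} → step M c ≡ nothing → config c ≡ (off + len , proj₂ (config c))
    simulate-halted {pc , v} h = cong (λ m → off + m , _) (m≥n⇒m⊓n≡n (nth-nothing⁻¹ progM (none h)))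
      where
        none : step M (pc , v) ≡ nothing → nth progM pc ≡ nothing
        none h with nth progM pc
        ... | nothing = refl

  zeros : Vec ℕ nregs
  zeros = replicate nregs 0

  module _ {α β n : ℕ} (n≡ : n ≡ α + β * iterate′ f₁ α (iterate′ f₂ β t₀)) where

    computes : ∀ {o} → HaltsWith M n o → Σ (Vec ℕ (suc nregs)) λ v → Σ ℕ λ t →
               V.head v ≡ o ×
               text ⊢ (0 , α ∷ β ∷ 0 ∷ 0 ∷ 0 ∷ 0 ∷ zeros) ⟶* (off + len , 0 ∷ 0 ∷ 0 ∷ t ∷ 0 ∷ v)
    computes (k , h , out≡) =
      proj₂ (run M k (initial M n)) , E , out≡ ,
      compile-correct (prelude-correct α β ▸ cong (regs {zeros} 0 0 0 E 0) (sym n≡))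
        0 (codeAt-++ˡ (compile prelude 0) _ (codeAt λ _ h → h)) ◅◅
      subst₂ (text ⊢_⟶*_) (cong (_, regs {zeros} 0 0 0 E 0 n) (+-identityʳ off)) (simulate-halted h) (simulate k (initial M n))
      where
        E = iterate′ f₁ α (iterate′ f₂ β t₀)

    accepts : HaltsWith M n 0 → Accepts 1 (α ∷ β ∷ 0 ∷ 0 ∷ 0 ∷ 0 ∷ zeros)
    accepts halts with computes halts
    ... | o ∷ v , t , refl , reach =
      backward* (reach ◅◅ (decr₀ (codeAt-head text-end) refl ◅ done)) (halted (codeAt-head (codeAt-tail text-end)))

    rejects : HaltsWith M n 1 → ¬ Accepts 1 (α ∷ β ∷ 0 ∷ 0 ∷ 0 ∷ 0 ∷ zeros)
    rejects halts acc with computes halts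
    ... | o ∷ v , t , refl , reach =
      stuck beyond (forward* (reach ◅◅ (decr₁ (codeAt-head text-end) refl ◅ done)) acc)
      where
        beyond : nth text (suc (suc (off + len))) ≡ nothing
        beyond = nth-nothing text (≤-reflexive (trans (LP.length-++ (compile prelude 0))
          (trans (cong₂ _+_ (length-compile prelude 0)
                   (trans (LP.length-++ (L.map embed progM)) (cong (_+ 2) (LP.length-map embed progM))))
            (trans (sym (+-assoc off len 2)) (+-comm (off + len) 2)))))

-- The code of the instance, layer by layer.

andCode : ℕ → ℕ → ℕ
andCode p n = code 6 (code 7 (code (code 6 p) (code 6 n)))

exCode : ℕ → ℕ → ℕ
exCode v n = code 8 (code v n)

affine-and : ∀ p → Affine (andCode p)
affine-and p = affine-∘ (affine-code 6) (affine-∘ (affine-code 7) (affine-∘ (affine-code (code 6 p)) (affine-code 6)))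

affine-ex : ∀ v → Affine (exCode v)
affine-ex v = affine-∘ (affine-code 8) (affine-code v)

-- The layer that one more letter a adds to the code of `reads`.
readCode : ℕ → ℕ → ℕ
readCode a n = andCode (code 1 (code a 0))
  (exCode 1 (andCode (code 5 (code 0 1)) (exCode 0 (andCode (code 2 (code 0 1)) n))))

affine-read : ∀ a → Affine (readCode a)
affine-read a = affine-∘ (affine-and (code 1 (code a 0))) (affine-∘ (affine-ex 1)
  (affine-∘ (affine-and (code 5 (code 0 1))) (affine-∘ (affine-ex 0) (affine-and (code 2 (code 0 1))))))

-- instanceCode n sysAct (spec as b) as a function of the code of reads as b,
-- where l, p, q are the codes of sysAct, failedQuery and violation.
specCode : (n l p q : ℕ) → ℕ → ℕ
specCode n l p q m = code n (code l (exCode 0 (exCode 1 (code 7 (code p (code 6 (code 7 (code q (code 6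
  (exCode 0 (andCode (code 6 (exCode 1 (code 4 (code 1 0)))) m)))))))))))

affine-spec : ∀ n l p q → Affine (specCode n l p q)
affine-spec n l p q = affine-∘ (affine-code n) (affine-∘ (affine-code l) (affine-∘ (affine-ex 0)
  (affine-∘ (affine-ex 1) (affine-∘ (affine-code 7) (affine-∘ (affine-code p) (affine-∘ (affine-code 6)
  (affine-∘ (affine-code 7) (affine-∘ (affine-code q) (affine-∘ (affine-code 6) (affine-∘ (affine-ex 0)
  (affine-and (code 6 (exCode 1 (code 4 (code 1 0)))))))))))))))

-- The self-referential instance.

module Instance (M : Machine) where

  private
    t₀ : ℕ
    -- The code of `act start x`: constructor 1, letter 2, variable 0.
    t₀ = code 1 (code 2 0)

  open Diagonal M (affine-read 0) (affine-read 1) t₀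
  open Formula rule

  nA : ℕ
  nA = length rules

  sysAct : Fin nA → Bool
  sysAct a = isSystem (tag (rule a))

  -- The alphabet and both fixed subformulas come from the program alone, so α and β are read off
  -- here without solving an equation.
  Outer : Affine (specCode nA (encList (L.tabulate (λ a → if sysAct a then 1 else 0)))
                           (formCode failedQuery) (formCode violation))
  Outer = affine-spec _ _ _ _

  α β : ℕ
  α = Affine.offset Outer
  β = Affine.slope Outer

  φ : Form nA
  φ = spec (loads α β) start

  formCode-reads : ∀ a b → formCode (reads (loads a b) start) ≡
                  iterate′ (readCode 0) a (iterate′ (readCode 1) b t₀)
  formCode-reads zero    zero    = refl
  formCode-reads zero    (suc b) =
    trans (cong (readCode 1) (formCode-reads 0 b)) (sym (iterate′-suc (readCode 1) b t₀))
  formCode-reads (suc a) b       =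
    trans (cong (readCode 0) (formCode-reads a b)) (sym (iterate′-suc (readCode 0) a _))

  instance-code : encInstance nA sysAct φ ≡ α + β * iterate′ (readCode 0) α (iterate′ (readCode 1) β t₀)
  instance-code = trans (sym (instanceCode-encInstance nA sysAct φ)) (trans (Affine.law Outer (formCode (reads (loads α β) start)))
                        (cong (λ m → α + β * m) (formCode-reads α β)))

  initial-tokens : ∀ {A : Set} → V.map length (replicate (6 + Machine.nregs M) (List.[] {A = A})) ≡
                   0 ∷ 0 ∷ 0 ∷ 0 ∷ 0 ∷ 0 ∷ zeros
  initial-tokens = VP.map-replicate length [] _

  won : HaltsWith M (encInstance nA sysAct φ) 0 → Σ ℕ λ k → Sem.InWin nA sysAct 0 0 k φ
  won halts = length word , Completeness.winning {0} {word} {loads α β} {start} run₀ ≤-refl λ n h →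
    trans (cong (λ l → nth l n) (sym (LP.∷ʳ-++ (loads α β) start bs))) (nth-++ˡ (loads α β ∷ʳ start) bs h)
    where
      accepted : Accepts 1 (α ∷ β ∷ 0 ∷ 0 ∷ 0 ∷ 0 ∷ zeros)
      accepted = accepts {α} {β} {encInstance nA sysAct φ} instance-code halts
      bs word : List (Fin nA)
      bs = proj₁ accepted
      word = loads α β ++ start ∷ bs
      open Semantics rule sysAct (λ _ → refl) (length word)
      run₀ : Run rule 0 (V.map length noTokens) word
      run₀ = subst (λ v → Run rule 0 v word) (sym initial-tokens)
               (load α β (subst₂ (λ a b → Run rule 1 (a ∷ b ∷ 0 ∷ 0 ∷ 0 ∷ 0 ∷ zeros) bs)
                 (sym (+-identityʳ α)) (sym (+-identityʳ β)) (proj₂ accepted)))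

  -- Stated for every instance with this code, as the problem ranges over all of them.
  lost : HaltsWith M (encInstance nA sysAct φ) 1 → ∀ {n f ψ} → SameInstance sysAct φ n f ψ →
         ∀ k → ¬ Sem.InWin n f 0 0 k ψ
  lost halts {f = f} (same f≡) k (strategy , win) =
    Semantics.Soundness.accepted rule f f≡ k query-on {loads α β} {start} strategy win
      λ (q , bs , run , agree) → rejects {α} {β} {encInstance nA sysAct φ} instance-code halts
        (subst₂ (λ a b → Accepts 1 (a ∷ b ∷ 0 ∷ 0 ∷ 0 ∷ 0 ∷ zeros)) (+-identityʳ α) (+-identityʳ β)
          (loaded α β (subst (λ v → Run rule q v bs) initial-tokens run) agree))

theorem1 : Undecidable SynthesisFO2-00N
theorem1 (M , decides) =
  -- A positive instance would make M output 1, hence be lost; so M outputs 0, which makes the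
  -- instance positive.
  notWon (nA , sysAct , φ , (refl , refl) , refl , won (proj₂ (decides n) notWon))
  where
    open Instance M
    n : ℕ
    n = encInstance nA sysAct φ
    notWon : ¬ SynthesisFO2-00N n
    notWon p@(n′ , f , ψ , _ , code≡ , k , win) =
      lost (proj₁ (decides n) p) (encInstance-injective sysAct φ n′ f ψ code≡) k win
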